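{- Let $G = G_{n,r,s}$ or $G = G^+_{n,r,s}$ be a graph in $\mathcal{G}$ with $r \le s$ and $n \ge 6$. (i) If $r=1$, the wheel $G^+_{n,1,n-3}$ has exactly $n-1$ maximal subdividable sets of edges; each consists of all edges of the rim together with exactly one spoke. (ii) If $r=2$ and either $G = G_{n,2,s}$ with $s\ge 4$ or $G = G^+_{n,2,s}$ with $s\ge 3$, then $G$ has exactly two maximal subdividable sets of edges: the edge set of the spine $v_1v_2\ldots v_n$ and the edge set of the path $v_{n-2}v_{n-3}\ldots v_2v_1v_{n-1}v_n$. (iii) If $r \ge 3$, the only maximal subdividable set of edges is the edge set of the spine $v_1v_2\ldots v_n$.
   Context: For $n \ge 3$ and $r,s \in \{0,1,\ldots,n-3\}$, the graph $G_{n,r,s}$ has vertex set $\{v_1,\ldots,v_n\}$ and consists of the path $v_1v_2\ldots v_n$ (the spine), the edges $v_1v_{n-i}$ for $1 \le i \le r$, and the edges $v_nv_{1+j}$ for $1 \le j \le s$; $G^+_{n,r,s}$ is $G_{n,r,s}$ plus the edge $v_1v_n$. $\mathcal{G}$ is the set of graphs of the form $G_{n,r,s}$ or $G^+_{n,r,s}$ that are $3$-connected and $K_{2,4}$-minor-free. $G^+_{n,1,n-3}$ is the wheel $K_1 + C_{n-1}$ with hub $v_n$; spokes are the edges at the hub and the rim is the cycle on the other vertices. If $G$ is $K_{2,4}$-minor-free, $F \subseteq E(G)$ is subdividable if the graph obtained from $G$ by subdividing each edge of $F$ once (replacing it by a path of length $2$) is $K_{2,4}$-minor-free; maximal means maximal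 under inclusion. -}

module Defs where

open import Data.Nat using (ℕ; zero; suc; _≤_; _<_; _∸_)
open import Data.Fin using (Fin; toℕ; _↑ˡ_; _↑ʳ_)
open import Data.Bool using (Bool; true; false)
open import Data.Product using (Σ; ∃; _×_; _,_; proj₁; proj₂)
open import Data.Sum using (_⊎_; inj₁; inj₂)
open import Data.Empty using (⊥)
open import Relation.Nullary using (¬_)
open import Relation.Binary.PropositionalEquality using (_≡_; _≢_)
open import Function.Bundles using (_⇔_)

-- General (simple, undirected) graphs: a vertex type and an adjacency
-- relation (always symmetric for the graphs built below).

record Graph : Set₁ where
  field
    V   : Set
    Adj : V → V → Set

open Graph public

data Path (G : Graph) (S : V G → Set) : V G → V G → Set where
  here : ∀ {x} → S x → Path G S x x
  step : ∀ {x y z} → S x → Adj G x y → Path G S y z → Path G S x z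

HasK24Minor : Graph → Set₁
HasK24Minor G =
  Σ (Fin 6 → V G → Set) λ B →
    (∀ i → ∃ λ x → B i x)
  × (∀ i j x → B i x → B j x → i ≡ j)
  × (∀ i x y → B i x → B i y → Path G (B i) x y)
  × (∀ (a : Fin 2) (b : Fin 4) →
       Σ (V G) λ x → Σ (V G) λ y →
         B (a ↑ˡ 4) x × B (2 ↑ʳ b) y × Adj G x y)

K24MinorFree : Graph → Set₁
K24MinorFree G = ¬ HasK24Minor G

-- The graphs G_{n,r,s} and G^+_{n,r,s}.  Vertex v_k (1 ≤ k ≤ n) is
-- represented by the element of Fin n with toℕ = k - 1.

-- Oriented edges (smaller index first), indices 0-based.
BaseEdge : (n r s : ℕ) (plus : Bool) → ℕ → ℕ → Set
BaseEdge n r s plus a b =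
    (b ≡ suc a)                                                  -- spine v_{a+1} v_{a+2}
  ⊎ (a ≡ 0 × ∃ λ i → 1 ≤ i × i ≤ r × b ≡ n ∸ 1 ∸ i)            -- v_1 v_{n-i}
  ⊎ (b ≡ n ∸ 1 × ∃ λ j → 1 ≤ j × j ≤ s × a ≡ j)                -- v_n v_{1+j}
  ⊎ (plus ≡ true × a ≡ 0 × b ≡ n ∸ 1)                          -- v_1 v_n (only in G^+)

GAdj : (n r s : ℕ) (plus : Bool) → Fin n → Fin n → Set
GAdj n r s plus a b =
  BaseEdge n r s plus (toℕ a) (toℕ b) ⊎ BaseEdge n r s plus (toℕ b) (toℕ a)

FinGraph : (n : ℕ) → (Fin n → Fin n → Set) → Graph
FinGraph n A = record { V = Fin n ; Adj = A }

GG : (n r s : ℕ) (plus : Bool) → Graph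
GG n r s plus = FinGraph n (GAdj n r s plus)

-- 3-connectivity: more than 3 vertices and deleting any at most two
-- vertices a, b (a = b allowed) leaves a connected graph.
ThreeConnected : (n : ℕ) → (Fin n → Fin n → Set) → Set
ThreeConnected n A =
  4 ≤ n × (∀ (a b u v : Fin n) → u ≢ a → u ≢ b → v ≢ a → v ≢ b →
             Path (FinGraph n A) (λ w → w ≢ a × w ≢ b) u v)

InClassG : (n r s : ℕ) (plus : Bool) → Set₁
InClassG n r s plus =
  ThreeConnected n (GAdj n r s plus) × K24MinorFree (GG n r s plus)

-- Sets of edges and subdivision.
-- A set of edges of a graph on Fin n with adjacency A is a Boolean
-- function F; the edge {a,b} (with toℕ a < toℕ b) belongs to F iff
-- F a b ≡ true.  IsEdgeSet requires that F only contains (oriented) edges.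

EdgeSet : ℕ → Set
EdgeSet n = Fin n → Fin n → Bool

IsEdgeSet : (n : ℕ) → (Fin n → Fin n → Set) → EdgeSet n → Set
IsEdgeSet n A F = ∀ a b → F a b ≡ true → (toℕ a < toℕ b) × A a b

_⊆ₑ_ : ∀ {n} → EdgeSet n → EdgeSet n → Set
F ⊆ₑ F′ = ∀ a b → F a b ≡ true → F′ a b ≡ true

SubVertex : (n : ℕ) → EdgeSet n → Set
SubVertex n F = Σ (Fin n × Fin n) λ p → F (proj₁ p) (proj₂ p) ≡ true

SubAdj : (n : ℕ) (A : Fin n → Fin n → Set) (F : EdgeSet n) →
         Fin n ⊎ SubVertex n F → Fin n ⊎ SubVertex n F → Set
SubAdj n A F (inj₁ a) (inj₁ b) = A a b × F a b ≡ false × F b a ≡ false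
SubAdj n A F (inj₁ a) (inj₂ ((x , y) , _)) = a ≡ x ⊎ a ≡ y
SubAdj n A F (inj₂ ((x , y) , _)) (inj₁ a) = a ≡ x ⊎ a ≡ y
SubAdj n A F (inj₂ _) (inj₂ _) = ⊥

Subdivide : (n : ℕ) → (Fin n → Fin n → Set) → EdgeSet n → Graph
Subdivide n A F = record { V = Fin n ⊎ SubVertex n F ; Adj = SubAdj n A F }

Subdividable : (n : ℕ) → (Fin n → Fin n → Set) → EdgeSet n → Set₁
Subdividable n A F = K24MinorFree (Subdivide n A F)

MaximalSubdividable : (n : ℕ) → (Fin n → Fin n → Set) → EdgeSet n → Set₁
MaximalSubdividable n A F =
  IsEdgeSet n A F × Subdividable n A F ×
  (∀ F′ → IsEdgeSet n A F′ → F ⊆ₑ F′ → Subdividable n A F′ → F′ ⊆ₑ F)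

_≐_ : ∀ {n} → EdgeSet n → (ℕ → ℕ → Set) → Set
_≐_ {n} F P = ∀ (a b : Fin n) → (F a b ≡ true) ⇔ P (toℕ a) (toℕ b)

SameEdges : (n : ℕ) → (ℕ → ℕ → Set) → (ℕ → ℕ → Set) → Set
SameEdges n P Q = ∀ (a b : Fin n) → P (toℕ a) (toℕ b) ⇔ Q (toℕ a) (toℕ b)

-- Specific edge sets (0-based indices, smaller endpoint first).

Spine : ℕ → ℕ → Set
Spine a b = b ≡ suc a

-- Path v_{n-2} v_{n-3} ... v_2 v_1 v_{n-1} v_n.
Path2 : ℕ → ℕ → ℕ → Set
Path2 n a b =
    (b ≡ suc a × b ≤ n ∸ 3)
  ⊎ (a ≡ 0 × b ≡ n ∸ 2)
  ⊎ (a ≡ n ∸ 2 × b ≡ n ∸ 1)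

-- Rim of the wheel with hub v_n: the cycle v_1 v_2 ... v_{n-1} v_1.
Rim : ℕ → ℕ → ℕ → Set
Rim n a b = (b ≡ suc a × b ≤ n ∸ 2) ⊎ (a ≡ 0 × b ≡ n ∸ 2)

-- Rim together with the spoke v_{k+1} v_n (0 ≤ k < n - 1).
RimSpoke : ℕ → ℕ → ℕ → ℕ → Set
RimSpoke n k a b = Rim n a b ⊎ (a ≡ k × b ≡ n ∸ 1)

{-# OPTIONS --safe #-}

-- Upper bounds. Every graph obtained by subdividing one of the claimed edge sets embeds
-- in a member of the class with r + s = n - 1 on more vertices, so it is enough that
-- these "hosts" have no K_{2,4} minor. Away from its two ends a host is a path, hence a
-- branch set avoiding the ends is an interval, with room for one neighbouring branch set
-- on each side. This settles all cases except when each hub holds an end; then a leaf is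
-- reached through the piece of a hub containing the first (or last) inner vertex, which
-- at most one leaf can use, or through pieces of both hubs reaching the common neighbour
-- c of the ends, which again at most one leaf can do: three leaves in total.
--
-- Lower bounds. For an edge (or pair of edges) that may not be subdivided, the path is
-- cut into a few segments, which form the branch sets of a minor whose remaining leaves
-- are the subdivision vertices of these edges.
module Submission where

open import Defs
open import Data.Nat
open import Data.Nat.Properties
open import Data.Bool using (Bool; true; false)
import Data.Bool.Properties as Bool
open import Data.Fin as Fin using (Fin; zero; suc; _↑ˡ_; _↑ʳ_; toℕ; inject₁; fromℕ; fromℕ<; #_)
import Data.Fin.Properties as Fin
open import Data.Vec using (Vec; []; _∷_; lookup)
open import Data.List using (List; []; _∷_)
open import Data.List.Relation.Unary.Any as Any using (Any)
open import Data.Product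
open import Data.Sum using (_⊎_; inj₁; inj₂; [_,_]′)
open import Data.Unit using (⊤; tt)
open import Data.Empty using (⊥; ⊥-elim)
open import Function
open import Relation.Nullary
open import Relation.Nullary.Decidable
open import Relation.Binary.PropositionalEquality
open import Relation.Binary.Definitions using (tri<; tri≈; tri>)
import Axiom.UniquenessOfIdentityProofs as UIP

-- In each claimed set the subdivided edges lie along a path through all vertices of the subdivision
-- such that every edge off the path has one of its two ends as an endpoint. A host is such a path
-- in which, by chords, the start sees only positions from c on and the end only positions up to c.
-- One excluded-minor argument therefore serves all three cases; only the order in which the
-- vertices are traversed changes. The obstacle for the lower bounds is that n is unbounded. The
-- segment boundaries are affine forms compared coefficientwise, so that a decision procedure, run
-- once, certifies a minor for every n. What is left by hand is the split by the position of the bad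
-- edge, with exceptions at n = 6 and n = 7. 3-connectivity enters for r ≤ 2, as r + s ≥ n - 2 (and
-- as the edge v_1v_n when r = 1); minor-freeness enters for r ≥ 3, as r + s ≤ n - 1.

private variable
  G H : Graph

-- Paths, minors and their transport

Connected : (G : Graph) → (V G → Set) → Set
Connected G S = ∀ x y → S x → S y → Path G S x y

source∈ : ∀ {S x y} → Path G S x y → S x
source∈ (here p)     = p
source∈ (step p _ _) = p

mapPath : ∀ {S T} (f : V G → V H) → (∀ {x} → S x → T (f x)) →
          (∀ {x y} → Adj G x y → Adj H (f x) (f y)) →
          ∀ {x y} → Path G S x y → Path H T (f x) (f y)
mapPath f S⇒T hom (here p)     = here (S⇒T p)
mapPath f S⇒T hom (step p e q) = step (S⇒T p) (hom e) (mapPath f S⇒T hom q)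

minor-embedding : (f : V G → V H) → (∀ {x y} → f x ≡ f y → x ≡ y) →
                  (∀ {x y} → Adj G x y → Adj H (f x) (f y)) →
                  HasK24Minor G → HasK24Minor H
minor-embedding {G} {H} f f-inj f-hom (B , inhabited , disjoint , connected , adjacent) =
  image , inhabited′ , disjoint′ , connected′ , adjacent′
  where
  image : Fin 6 → V H → Set
  image i y = ∃ λ x → B i x × f x ≡ y
  inhabited′ : ∀ i → ∃ (image i)
  inhabited′ i = let x , p = inhabited i in f x , x , p , refl
  disjoint′ : ∀ i j y → image i y → image j y → i ≡ j
  disjoint′ i j _ (x , p , refl) (x′ , p′ , eq) =
    disjoint i j x p (subst (B j) (f-inj eq) p′)
  connected′ : ∀ i → Connected H (image i)
  connected′ i _ _ (x , p , refl) (x′ , p′ , refl) =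
    mapPath f (λ {x} q → x , q , refl) f-hom (connected i x x′ p p′)
  adjacent′ : ∀ (a : Fin 2) (b : Fin 4) → Σ (V H) λ x → Σ (V H) λ y →
              image (a ↑ˡ 4) x × image (2 ↑ʳ b) y × Adj H x y
  adjacent′ a b = let x , y , p , q , e = adjacent a b in
    f x , f y , (x , p , refl) , (y , q , refl) , f-hom e

-- Branch sets are arbitrary predicates, so it cannot be decided which of them hold an end of the
-- host. Excluding a minor is a negative goal, for which decidability up to double negation is
-- enough.
¬¬-decidable : ∀ {k} (P : Fin k → Set) → ¬ ¬ (∀ i → Dec (P i))
¬¬-decidable {zero}  P ¬dec = ¬dec λ ()
¬¬-decidable {suc k} P ¬dec = ¬¬-excluded-middle λ P₀? →
  ¬¬-decidable (P ∘ suc) λ P₊? → ¬dec λ where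
    zero    → P₀?
    (suc i) → P₊? i

-- All exclusion arguments end here: four leaves, but only three places for a leaf, each with room
-- for one.
three-boxes : (P : Fin 3 → Fin 4 → Set) → (∀ b → ∃ λ k → P k b) →
              (∀ k {i j} → i ≢ j → P k i → ¬ P k j) → ⊥
three-boxes P box exclusive with Fin.pigeonhole (n<1+n 3) (proj₁ ∘ box)
... | i , j , i<j , eq =
  exclusive _ (Fin.<⇒≢ i<j) (subst (λ k → P k i) eq (proj₂ (box i))) (proj₂ (box j))

-- The maximal members of the class, up to isomorphism: with m = n - 1 this is
-- G⁺ with r + s = n - 1, whose common neighbour of the two ends sits at c.
-- Naturals above m are isolated vertices.
data HostAdj (m c : ℕ) : ℕ → ℕ → Set where
  up         : ∀ {x} → x < m → HostAdj m c x (suc x)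
  down       : ∀ {x} → x < m → HostAdj m c (suc x) x
  from-start : ∀ {x} → c ≤ x → x ≤ m → HostAdj m c 0 x
  to-start   : ∀ {x} → c ≤ x → x ≤ m → HostAdj m c x 0
  from-end   : ∀ {x} → x ≤ c → x ≤ m → HostAdj m c m x
  to-end     : ∀ {x} → x ≤ c → x ≤ m → HostAdj m c x m

HostAdj-sym : ∀ {m c x y} → HostAdj m c x y → HostAdj m c y x
HostAdj-sym (up p)           = down p
HostAdj-sym (down p)         = up p
HostAdj-sym (from-start p q) = to-start p q
HostAdj-sym (to-start p q)   = from-start p q
HostAdj-sym (from-end p q)   = to-end p q
HostAdj-sym (to-end p q)     = from-end p q

Host : ℕ → ℕ → Graph
Host m c = record { V = ℕ ; Adj = HostAdj m c }

-- Hosts have no K_{2,4} minor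

module _ {m c : ℕ} where

  private variable
    S T S′ T′ : ℕ → Set
    x y z : ℕ

  Disjoint : (ℕ → Set) → (ℕ → Set) → Set
  Disjoint S T = ∀ {x} → S x → ¬ T x

  record Plain (S : ℕ → Set) : Set where
    field
      0∉        : ¬ S 0
      m∉        : ¬ S m
      connected : Connected (Host m c) S
  open Plain

  -- Every edge other than `up` and `down` uses 0 or m, so a path avoiding both moves by one at each
  -- step and cannot jump over z.
  between : ¬ S 0 → ¬ S m → Path (Host m c) S x y → x ≤ z → z ≤ y → S z
  between 0∉S m∉S (here p) x≤z z≤x = subst _ (≤-antisym x≤z z≤x) p
  between {x = x} {z = z} 0∉S m∉S (step p e q) x≤z z≤y with m≤n⇒m<n∨m≡n x≤z | e
  ... | inj₂ refl | _              = p
  ... | inj₁ x<z  | up _           = between 0∉S m∉S q x<z z≤y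
  ... | inj₁ x<z  | down _         = between 0∉S m∉S q (≤-trans (n≤1+n _) x≤z) z≤y
  ... | inj₁ _    | from-start _ _ = ⊥-elim (0∉S p)
  ... | inj₁ _    | to-start _ _   = ⊥-elim (0∉S (source∈ q))
  ... | inj₁ _    | from-end _ _   = ⊥-elim (m∉S p)
  ... | inj₁ _    | to-end _ _     = ⊥-elim (m∉S (source∈ q))

  convex : Plain S → S x → S y → x ≤ z → z ≤ y → S z
  convex P p q = between (0∉ P) (m∉ P) (connected P _ _ p q)

  adjacent-≤ : HostAdj m c x y → x ≤ m
  adjacent-≤ (up x<m)           = <⇒≤ x<m
  adjacent-≤ (down x<m)         = x<m
  adjacent-≤ (from-start _ _)   = z≤n
  adjacent-≤ (to-start _ x≤m)   = x≤m
  adjacent-≤ (from-end _ _)     = ≤-refl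
  adjacent-≤ (to-end _ x≤m)     = x≤m

  plain< : Plain S → S x → HostAdj m c x y → x < m
  plain< P p e = ≤∧≢⇒< (adjacent-≤ e) λ where refl → m∉ P p

  -- T sits immediately to the right of S.
  _▹_ : (ℕ → Set) → (ℕ → Set) → Set
  S ▹ T = ∃ λ x → S x × T (suc x)

  touching : Plain S → Plain T → S x → T y → HostAdj m c x y → S ▹ T ⊎ T ▹ S
  touching P Q p q (up _)           = inj₁ (_ , p , q)
  touching P Q p q (down _)         = inj₂ (_ , q , p)
  touching P Q p q (from-start _ _) = ⊥-elim (0∉ P p)
  touching P Q p q (to-start _ _)   = ⊥-elim (0∉ Q q)
  touching P Q p q (from-end _ _)   = ⊥-elim (m∉ P p)
  touching P Q p q (to-end _ _)     = ⊥-elim (m∉ Q q)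

  -- The x in `S ▹ T` is the maximum of S, since a larger element would by convexity put suc x into
  -- S. Hence T and T′ would share suc x.
  ▹-rightUnique : Plain S → Disjoint S T → Disjoint S T′ → Disjoint T T′ →
                  S ▹ T → ¬ S ▹ T′
  ▹-rightUnique P S#T S#T′ T#T′ (x , p , q) (x′ , p′ , q′) with <-cmp x x′
  ... | tri< x<x′ _ _ = S#T (convex P p p′ (n≤1+n x) x<x′) q
  ... | tri≈ _ refl _ = T#T′ q q′
  ... | tri> _ _ x′<x = S#T′ (convex P p′ p (n≤1+n x′) x′<x) q′

  ▹-leftUnique : Plain T → Disjoint S T → Disjoint S′ T → Disjoint S S′ →
                 S ▹ T → ¬ S′ ▹ T
  ▹-leftUnique P S#T S′#T S#S′ (x , p , q) (x′ , p′ , q′) with <-cmp x x′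
  ... | tri< x<x′ _ _ = S′#T p′ (convex P q q′ x<x′ (n≤1+n x′))
  ... | tri≈ _ refl _ = S#S′ p p′
  ... | tri> _ _ x′<x = S#T p (convex P q′ q x′<x (n≤1+n x))

  ▹⇒< : Plain S → Plain T → Disjoint S T → S ▹ T → S x → T y → x < y
  ▹⇒< {x = x} {y = y} P Q S#T (z , p , q) p′ q′ = ≤-<-trans x≤z z<y
    where
    x≤z : x ≤ z
    x≤z = ≮⇒≥ λ z<x → S#T (convex P p p′ (n≤1+n z) z<x) q
    z<y : z < y
    z<y = ≰⇒> λ y≤z → S#T p (convex Q q′ q y≤z (n≤1+n z))

  ▹-acyclic : Plain S → Plain T → Plain S′ → Plain T′ →
              Disjoint S T → Disjoint T S′ → Disjoint S′ T′ → Disjoint T′ S →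
              S ▹ T → T ▹ S′ → S′ ▹ T′ → ¬ T′ ▹ S
  ▹-acyclic P Q P′ Q′ d₁ d₂ d₃ d₄ a@(s , p , _) b@(t , q , _) a′@(s′ , p′ , _) b′@(t′ , q′ , _) =
    <-irrefl {s} refl (<-trans (▹⇒< P Q d₁ a p q) (<-trans (▹⇒< Q P′ d₂ b q p′)
      (<-trans (▹⇒< P′ Q′ d₃ a′ p′ q′) (▹⇒< Q′ P d₄ b′ q′ p))))

  -- The four sets would be intervals touching in a 4-cycle. An interval has at most one neighbour
  -- on each side, so the cycle would have to run in one direction throughout, against the order of
  -- the line.
  no-plain-4-cycle : Plain S → Plain T → Plain S′ → Plain T′ →
                     Disjoint S T → Disjoint S T′ → Disjoint S′ T → Disjoint S′ T′ →
                     Disjoint S S′ → Disjoint T T′ →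
                     S ▹ T ⊎ T ▹ S → S ▹ T′ ⊎ T′ ▹ S →
                     S′ ▹ T ⊎ T ▹ S′ → ¬ (S′ ▹ T′ ⊎ T′ ▹ S′)
  no-plain-4-cycle P Q P′ Q′ ST ST′ S′T S′T′ SS′ TT′ e₁ e₂ e₃ e₄ = go e₁ e₂ e₃ e₄
    where
    go : _ → _ → _ → _ → ⊥
    go (inj₁ a) (inj₁ b) _ _ = ▹-rightUnique P ST ST′ TT′ a b
    go (inj₂ a) (inj₂ b) _ _ = ▹-leftUnique P (flip ST) (flip ST′) TT′ a b
    go (inj₁ a) (inj₂ b) (inj₁ d) _ = ▹-leftUnique Q ST S′T SS′ a d
    go (inj₁ a) (inj₂ b) (inj₂ d) (inj₂ e) = ▹-rightUnique Q′ (flip ST′) (flip S′T′) SS′ b e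
    go (inj₁ a) (inj₂ b) (inj₂ d) (inj₁ e) =
      ▹-acyclic P Q P′ Q′ ST (flip S′T) S′T′ (flip ST′) a d e b
    go (inj₂ a) (inj₁ b) (inj₂ d) _ = ▹-rightUnique Q (flip ST) (flip S′T) SS′ a d
    go (inj₂ a) (inj₁ b) (inj₁ d) (inj₁ e) = ▹-leftUnique Q′ ST′ S′T′ SS′ b e
    go (inj₂ a) (inj₁ b) (inj₁ d) (inj₂ e) =
      ▹-acyclic P Q′ P′ Q ST′ (flip S′T′) S′T (flip ST) b e d a

  -- A path avoiding m enters 0 either from 1 or along a chord from a position ≥ c. Until then it
  -- moves by single steps, so it sweeps everything down to 1 or everything up to c; the second
  -- range is empty if x lies beyond c.
  start-piece : ¬ S m → Path (Host m c) S x 0 →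
                x ≡ 0 ⊎ (∀ {z} → 1 ≤ z → z ≤ x → S z) ⊎ (∀ {z} → x ≤ z → z ≤ c → S z)
  start-piece m∉S (here p) = inj₁ refl
  start-piece m∉S (step p (from-start _ _) q) = inj₁ refl
  start-piece m∉S (step p (from-end _ _) q) = ⊥-elim (m∉S p)
  start-piece m∉S (step p (to-end _ _) q) = ⊥-elim (m∉S (source∈ q))
  start-piece m∉S (step p (to-start c≤x _) q) =
    inj₂ (inj₂ λ x≤z z≤c → subst _ (≤-antisym x≤z (≤-trans z≤c c≤x)) p)
  start-piece m∉S (step p (up _) q) with start-piece m∉S q
  ... | inj₂ (inj₁ below) = inj₂ (inj₁ λ 1≤z z≤x → below 1≤z (m≤n⇒m≤1+n z≤x))
  ... | inj₂ (inj₂ above) = inj₂ (inj₂ λ x≤z z≤c → case m≤n⇒m<n∨m≡n x≤z of λ where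
    (inj₁ x<z)  → above x<z z≤c
    (inj₂ refl) → p)
  start-piece {S = S} m∉S (step p (down _) q) with start-piece m∉S q
  ... | inj₁ refl         = inj₂ (inj₁ λ 1≤z z≤1 → subst S (≤-antisym 1≤z z≤1) p)
  ... | inj₂ (inj₁ below) = inj₂ (inj₁ λ 1≤z z≤x → case m≤n⇒m<n∨m≡n z≤x of λ where
    (inj₁ (s≤s z≤y)) → below 1≤z z≤y
    (inj₂ refl)      → p)
  ... | inj₂ (inj₂ above) = inj₂ (inj₂ λ x≤z → above (≤-trans (n≤1+n _) x≤z))

  end-piece : ¬ S 0 → Path (Host m c) S x m →
              x ≡ m ⊎ (∀ {z} → x ≤ z → z < m → S z) ⊎ (∀ {z} → c ≤ z → z ≤ x → S z)
  end-piece 0∉S (here p) = inj₁ refl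
  end-piece 0∉S (step p (from-end _ _) q) = inj₁ refl
  end-piece 0∉S (step p (from-start _ _) q) = ⊥-elim (0∉S p)
  end-piece 0∉S (step p (to-start _ _) q) = ⊥-elim (0∉S (source∈ q))
  end-piece 0∉S (step p (to-end x≤c _) q) =
    inj₂ (inj₂ λ c≤z z≤x → subst _ (≤-antisym (≤-trans x≤c c≤z) z≤x) p)
  end-piece 0∉S (step p (down x<m) q) with end-piece 0∉S q
  ... | inj₁ refl         = ⊥-elim (<-irrefl refl x<m)
  ... | inj₂ (inj₁ above) = inj₂ (inj₁ λ x≤z → above (≤-trans (n≤1+n _) x≤z))
  ... | inj₂ (inj₂ below) = inj₂ (inj₂ λ c≤z z≤x → case m≤n⇒m<n∨m≡n z≤x of λ where
    (inj₁ (s≤s z≤y)) → below c≤z z≤y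
    (inj₂ refl)      → p)
  end-piece {S = S} 0∉S (step p (up _) q) with end-piece 0∉S q
  ... | inj₁ refl         = inj₂ (inj₁ λ x≤z z<m → subst S (≤-antisym x≤z (s≤s⁻¹ z<m)) p)
  ... | inj₂ (inj₁ above) = inj₂ (inj₁ λ x≤z z<m → case m≤n⇒m<n∨m≡n x≤z of λ where
    (inj₁ x<z)  → above x<z z<m
    (inj₂ refl) → p)
  ... | inj₂ (inj₂ below) = inj₂ (inj₂ λ c≤z z≤x → below c≤z (m≤n⇒m≤1+n z≤x))

  -- The two hubs hold the two ends of the path. Each plain set touching both is
  -- classified by the pieces of the hubs it touches: the piece of A next to 0,
  -- the piece of A′ next to m, or, failing both, pieces reaching c.
  module _ {A A′ : ℕ → Set} (A∋0 : A 0) (A′∋m : A′ m) (A#A′ : Disjoint A A′)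
           (A-conn : Connected (Host m c) A) (A′-conn : Connected (Host m c) A′) where

    m∉A : ¬ A m
    m∉A p = A#A′ p A′∋m

    0∉A′ : ¬ A′ 0
    0∉A′ = A#A′ A∋0

    -- The bounds are strict so that a leaf touching an end of the path directly satisfies them with
    -- an empty range. `Late` asks for x < m because the isolated vertices above m would satisfy the
    -- rest vacuously.
    Early Late Central : (ℕ → Set) → Set
    Early S   = ∃ λ x → S x × (∀ {z} → 1 ≤ z → z < x → A z)
    Late S    = ∃ λ x → S x × x < m × (∀ {z} → x < z → z < m → A′ z)
    Central S = (∃ λ x → S x × (∀ {z} → x < z → z ≤ c → A z))
              × (∃ λ y → S y × (∀ {z} → c ≤ z → z < y → A′ z))

    early-or-reaching : Plain S → S x → A y → HostAdj m c x y →
                        Early S ⊎ (∃ λ x → S x × (∀ {z} → x < z → z ≤ c → A z))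
    early-or-reaching P p q (up _) with start-piece m∉A (A-conn _ _ q A∋0)
    -- Here x itself would lie in A; the case is classified rather than refuted, since disjointness
    -- of S and A is only assumed later.
    ... | inj₂ (inj₁ below) = inj₁ (_ , p , λ 1≤z z<x → below 1≤z (≤-trans (<⇒≤ z<x) (n≤1+n _)))
    ... | inj₂ (inj₂ above) = inj₂ (_ , p , above)
    early-or-reaching P p q (down _) with start-piece m∉A (A-conn _ _ q A∋0)
    ... | inj₁ refl         = inj₁ (_ , p , λ 1≤z z<1 → ⊥-elim (<⇒≱ z<1 1≤z))
    ... | inj₂ (inj₁ below) = inj₁ (_ , p , λ 1≤z z<x → below 1≤z (s≤s⁻¹ z<x))
    ... | inj₂ (inj₂ above) = inj₂ (_ , p , λ x<z → above (≤-trans (n≤1+n _) (<⇒≤ x<z)))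
    early-or-reaching P p q (from-start _ _) = ⊥-elim (0∉ P p)
    early-or-reaching P p q (to-start c≤x _) =
      inj₂ (_ , p , λ x<z z≤c → ⊥-elim (<⇒≱ x<z (≤-trans z≤c c≤x)))
    early-or-reaching P p q (from-end _ _) = ⊥-elim (m∉ P p)
    early-or-reaching P p q (to-end _ _)   = ⊥-elim (m∉A q)

    late-or-reaching : Plain S → S x → A′ y → HostAdj m c x y →
                       Late S ⊎ (∃ λ y → S y × (∀ {z} → c ≤ z → z < y → A′ z))
    late-or-reaching P p q e@(down y<m) with end-piece 0∉A′ (A′-conn _ _ q A′∋m)
    ... | inj₁ refl         = ⊥-elim (<-irrefl refl y<m)
    ... | inj₂ (inj₁ above) = inj₁ (_ , p , plain< P p e , λ x<z → above (≤-trans (n≤1+n _) (<⇒≤ x<z)))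
    ... | inj₂ (inj₂ below) = inj₂ (_ , p , λ c≤z z<x → below c≤z (s≤s⁻¹ z<x))
    late-or-reaching P p q e@(up _) with end-piece 0∉A′ (A′-conn _ _ q A′∋m)
    ... | inj₁ refl         = inj₁ (_ , p , plain< P p e , λ x<z z<m → ⊥-elim (<⇒≱ x<z (s≤s⁻¹ z<m)))
    ... | inj₂ (inj₁ above) = inj₁ (_ , p , plain< P p e , above)
    ... | inj₂ (inj₂ below) = inj₂ (_ , p , λ c≤z z<x → below c≤z (≤-trans (<⇒≤ z<x) (n≤1+n _)))
    late-or-reaching P p q (from-end _ _) = ⊥-elim (m∉ P p)
    late-or-reaching P p q (to-end x≤c _) =
      inj₂ (_ , p , λ c≤z z<x → ⊥-elim (<⇒≱ z<x (≤-trans x≤c c≤z)))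
    late-or-reaching P p q (from-start _ _) = ⊥-elim (0∉ P p)
    late-or-reaching P p q (to-start _ _)   = ⊥-elim (0∉A′ q)

    classify : Plain S → (∃ λ x → ∃ λ y → S x × A y × HostAdj m c x y) →
               (∃ λ x → ∃ λ y → S x × A′ y × HostAdj m c x y) → Early S ⊎ Late S ⊎ Central S
    classify P (x , y , p , q , e) (x′ , y′ , p′ , q′ , e′)
      with early-or-reaching P p q e | late-or-reaching P p′ q′ e′
    ... | inj₁ early | _         = inj₁ early
    ... | inj₂ _     | inj₁ late = inj₂ (inj₁ late)
    ... | inj₂ r     | inj₂ r′   = inj₂ (inj₂ (r , r′))

    -- Of two witnesses the smaller lies in the stretch that A fills before the larger one, although
    -- its own set avoids A.
    early-unique : Plain S → Plain T → Disjoint S T → Disjoint S A → Disjoint T A →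
                   Early S → ¬ Early T
    early-unique P Q S#T S#A T#A (x , p , f) (y , q , g) with <-cmp x y
    ... | tri< x<y _ _ = S#A p (g (n≢0⇒n>0 λ where refl → 0∉ P p) x<y)
    ... | tri≈ _ refl _ = S#T p q
    ... | tri> _ _ y<x = T#A q (f (n≢0⇒n>0 λ where refl → 0∉ Q q) y<x)

    late-unique : Disjoint S T → Disjoint S A′ → Disjoint T A′ → Late S → ¬ Late T
    late-unique S#T S#A T#A (x , p , x<m , f) (y , q , y<m , g) with <-cmp x y
    ... | tri< x<y _ _ = T#A q (f x<y y<m)
    ... | tri≈ _ refl _ = S#T p q
    ... | tri> _ _ y<x = S#A p (g y<x x<m)

    -- If x < c, the stretch (x, c] of A contains c; if c < y, the stretch [c, y) of A′ does;
    -- otherwise y ≤ c ≤ x and convexity puts c into S. As c has one owner, two central leaves fall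
    -- into the same case, where comparing witnesses works as for early leaves.
    c-owner : Plain S → Central S →
              S c ⊎ (A c × ∃ λ x → S x × (∀ {z} → x < z → z ≤ c → A z) × x < c)
                  ⊎ (A′ c × ∃ λ y → S y × (∀ {z} → c ≤ z → z < y → A′ z) × c < y)
    c-owner P ((x , p , f) , (y , q , g)) with x <? c | c <? y
    ... | yes x<c | _       = inj₂ (inj₁ (f x<c ≤-refl , x , p , f , x<c))
    ... | no _    | yes c<y = inj₂ (inj₂ (g ≤-refl c<y , y , q , g , c<y))
    ... | no x≮c  | no c≮y  = inj₁ (convex P q p (≮⇒≥ c≮y) (≮⇒≥ x≮c))

    central-unique : Plain S → Plain T → Disjoint S T →
                     Disjoint S A → Disjoint T A → Disjoint S A′ → Disjoint T A′ →
                     Central S → ¬ Central T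
    central-unique P Q S#T S#A T#A S#A′ T#A′ s t with c-owner P s | c-owner Q t
    ... | inj₁ S∋c | inj₁ T∋c = S#T S∋c T∋c
    ... | inj₁ S∋c | inj₂ (inj₁ (A∋c , _)) = S#A S∋c A∋c
    ... | inj₁ S∋c | inj₂ (inj₂ (A′∋c , _)) = S#A′ S∋c A′∋c
    ... | inj₂ (inj₁ (A∋c , _)) | inj₁ T∋c = T#A T∋c A∋c
    ... | inj₂ (inj₂ (A′∋c , _)) | inj₁ T∋c = T#A′ T∋c A′∋c
    ... | inj₂ (inj₁ (A∋c , _)) | inj₂ (inj₂ (A′∋c , _)) = A#A′ A∋c A′∋c
    ... | inj₂ (inj₂ (A′∋c , _)) | inj₂ (inj₁ (A∋c , _)) = A#A′ A∋c A′∋c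
    ... | inj₂ (inj₁ (_ , x , p , f , x<c)) | inj₂ (inj₁ (_ , y , q , g , y<c)) = case <-cmp x y of λ where
      (tri< x<y _ _)  → T#A q (f x<y (<⇒≤ y<c))
      (tri≈ _ refl _) → S#T p q
      (tri> _ _ y<x)  → S#A p (g y<x (<⇒≤ x<c))
    ... | inj₂ (inj₂ (_ , x , p , f , c<x)) | inj₂ (inj₂ (_ , y , q , g , c<y)) = case <-cmp x y of λ where
      (tri< x<y _ _)  → S#A′ p (g (<⇒≤ c<x) x<y)
      (tri≈ _ refl _) → S#T p q
      (tri> _ _ y<x)  → T#A′ q (f (<⇒≤ c<y) y<x)

  no-K24-with-end-hubs :
    ∀ {A A′ : ℕ → Set} {D : Fin 4 → ℕ → Set} → A 0 → A′ m → Disjoint A A′ →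
    Connected (Host m c) A → Connected (Host m c) A′ → (∀ b → Plain (D b)) →
    (∀ b → Disjoint (D b) A) → (∀ b → Disjoint (D b) A′) → (∀ {b b′} → b ≢ b′ → Disjoint (D b) (D b′)) →
    (∀ b → ∃ λ x → ∃ λ y → D b x × A y × HostAdj m c x y) →
    (∀ b → ∃ λ x → ∃ λ y → D b x × A′ y × HostAdj m c x y) → ⊥
  no-K24-with-end-hubs {A} {A′} {D} A∋0 A′∋m A#A′ A-conn A′-conn P D#A D#A′ D#D e e′ =
    three-boxes Box box exclusive
    where
    Box : Fin 3 → Fin 4 → Set
    Box zero             b = Early A∋0 A′∋m A#A′ A-conn A′-conn (D b)
    Box (suc zero)       b = Late A∋0 A′∋m A#A′ A-conn A′-conn (D b)
    Box (suc (suc zero)) b = Central A∋0 A′∋m A#A′ A-conn A′-conn (D b)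
    box : ∀ b → ∃ λ k → Box k b
    box b with classify A∋0 A′∋m A#A′ A-conn A′-conn (P b) (e b) (e′ b)
    ... | inj₁ early          = zero , early
    ... | inj₂ (inj₁ late)    = suc zero , late
    ... | inj₂ (inj₂ central) = suc (suc zero) , central
    exclusive : ∀ k {i j} → i ≢ j → Box k i → ¬ Box k j
    exclusive zero             i≢j = early-unique A∋0 A′∋m A#A′ A-conn A′-conn (P _) (P _) (D#D i≢j) (D#A _) (D#A _)
    exclusive (suc zero)       i≢j = late-unique A∋0 A′∋m A#A′ A-conn A′-conn (D#D i≢j) (D#A′ _) (D#A′ _)
    exclusive (suc (suc zero)) i≢j =
      central-unique A∋0 A′∋m A#A′ A-conn A′-conn (P _) (P _) (D#D i≢j) (D#A _) (D#A _) (D#A′ _) (D#A′ _)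

  -- A plain hub has room for one leaf on each side; e is the only end a leaf can hold.
  no-K24-with-plain-hub :
    ∀ {A : ℕ → Set} {D : Fin 4 → ℕ → Set} {e : ℕ} → Plain A →
    (∀ b → Dec (D b e)) → (∀ b → ¬ D b e → Plain (D b)) →
    (∀ b → Disjoint (D b) A) → (∀ {b b′} → b ≢ b′ → Disjoint (D b) (D b′)) →
    (∀ b → ∃ λ x → ∃ λ y → D b x × A y × HostAdj m c x y) → ⊥
  no-K24-with-plain-hub {A} {D} {e} P e∈? plain D#A D#D adj = three-boxes Box box exclusive
    where
    Box : Fin 3 → Fin 4 → Set
    Box zero             b = D b e
    Box (suc zero)       b = A ▹ D b
    Box (suc (suc zero)) b = D b ▹ A
    box : ∀ b → ∃ λ k → Box k b
    box b with e∈? b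
    ... | yes D∋e = zero , D∋e
    ... | no  D∌e with _ , _ , p , q , h ← adj b | touching (plain b D∌e) P p q h
    ...   | inj₁ D▹A = suc (suc zero) , D▹A
    ...   | inj₂ A▹D = suc zero , A▹D
    exclusive : ∀ k {i j} → i ≢ j → Box k i → ¬ Box k j
    exclusive zero             i≢j = D#D i≢j
    exclusive (suc zero)       i≢j = ▹-rightUnique P (flip (D#A _)) (flip (D#A _)) (D#D i≢j)
    exclusive (suc (suc zero)) i≢j = ▹-leftUnique P (D#A _) (D#A _) (D#D i≢j)

  -- A leaf holds 0, holds m, or is plain. Two plain leaves would close a 4-cycle of intervals with
  -- the hubs, so each kind occurs at most once.
  no-K24-with-plain-hubs :
    ∀ {A A′ : ℕ → Set} {D : Fin 4 → ℕ → Set} → Plain A → Plain A′ → Disjoint A A′ →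
    (∀ b → Dec (D b 0)) → (∀ b → Dec (D b m)) → (∀ b → Connected (Host m c) (D b)) →
    (∀ b → Disjoint (D b) A) → (∀ b → Disjoint (D b) A′) → (∀ {b b′} → b ≢ b′ → Disjoint (D b) (D b′)) →
    (∀ b → ∃ λ x → ∃ λ y → D b x × A y × HostAdj m c x y) →
    (∀ b → ∃ λ x → ∃ λ y → D b x × A′ y × HostAdj m c x y) → ⊥
  no-K24-with-plain-hubs {A} {A′} {D} P P′ A#A′ 0∈? m∈? D-conn D#A D#A′ D#D e e′ =
    three-boxes Box box exclusive
    where
    Box : Fin 3 → Fin 4 → Set
    Box zero             b = D b 0
    Box (suc zero)       b = D b m
    Box (suc (suc zero)) b = Plain (D b)
    box : ∀ b → ∃ λ k → Box k b
    box b with 0∈? b | m∈? b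
    ... | yes p | _     = zero , p
    ... | no _  | yes p = suc zero , p
    ... | no p  | no q  = suc (suc zero) , record { 0∉ = p ; m∉ = q ; connected = D-conn b }
    side : ∀ {S b} → Plain S → Plain (D b) → (∃ λ x → ∃ λ y → D b x × S y × HostAdj m c x y) →
           S ▹ D b ⊎ D b ▹ S
    side P Q (_ , _ , p , q , h) = touching P Q q p (HostAdj-sym h)
    exclusive : ∀ k {i j} → i ≢ j → Box k i → ¬ Box k j
    exclusive zero             i≢j = D#D i≢j
    exclusive (suc zero)       i≢j = D#D i≢j
    exclusive (suc (suc zero)) {i} {j} i≢j Q Q′ =
      no-plain-4-cycle P Q P′ Q′ (flip (D#A i)) (flip (D#A j)) (flip (D#A′ i)) (flip (D#A′ j)) A#A′ (D#D i≢j)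
        (side P Q (e i)) (side P Q′ (e j)) (side P′ Q (e′ i)) (side P′ Q′ (e′ j))

  host-K24MinorFree : K24MinorFree (Host m c)
  host-K24MinorFree (B , _ , disjoint , connected , adjacent) =
    ¬¬-decidable (λ i → B i 0) λ 0∈? → ¬¬-decidable (λ i → B i m) λ m∈? → contra 0∈? m∈?
    where
    apart : ∀ {i j} → i ≢ j → Disjoint (B i) (B j)
    apart i≢j p q = i≢j (disjoint _ _ _ p q)
    leaf : Fin 4 → ℕ → Set
    leaf b = B (2 ↑ʳ b)
    leaf-apart : ∀ {b b′} → b ≢ b′ → Disjoint (leaf b) (leaf b′)
    leaf-apart b≢b′ = apart (b≢b′ ∘ Fin.↑ʳ-injective 2 _ _)
    touches : ∀ a b → ∃ λ x → ∃ λ y → leaf b x × B (a ↑ˡ 4) y × HostAdj m c x y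
    touches a b = let x , y , p , q , e = adjacent a b in y , x , q , p , HostAdj-sym e
    plain : ∀ i → ¬ B i 0 → ¬ B i m → Plain (B i)
    plain i p q = record { 0∉ = p ; m∉ = q ; connected = connected i }
    contra : (∀ i → Dec (B i 0)) → (∀ i → Dec (B i m)) → ⊥
    -- If only one hub holds an end, the other hub is plain and the leaves compete for the remaining
    -- end. This includes a hub that holds both ends.
    contra 0∈? m∈? with 0∈? zero | m∈? zero | 0∈? (suc zero) | m∈? (suc zero)
    ... | yes p | _ | _ | yes q =
      no-K24-with-end-hubs p q (apart λ ()) (connected _) (connected _)
        (λ b → plain _ (λ r → apart (λ ()) p r) (λ r → apart (λ ()) q r))
        (λ b → apart λ ()) (λ b → apart λ ()) leaf-apart (touches zero) (touches (suc zero))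
    ... | yes p | _ | _ | no ¬q =
      no-K24-with-plain-hub (plain (suc zero) (apart (λ ()) p) ¬q) (m∈? ∘ (2 ↑ʳ_))
        (λ b → plain _ (apart (λ ()) p)) (λ b → apart λ ()) leaf-apart (touches (suc zero))
    ... | no _ | yes p | yes q | _ =
      no-K24-with-end-hubs q p (apart λ ()) (connected _) (connected _)
        (λ b → plain _ (λ r → apart (λ ()) q r) (λ r → apart (λ ()) p r))
        (λ b → apart λ ()) (λ b → apart λ ()) leaf-apart (touches (suc zero)) (touches zero)
    ... | no _ | yes p | no ¬q | _ =
      no-K24-with-plain-hub (plain (suc zero) ¬q (apart (λ ()) p)) (0∈? ∘ (2 ↑ʳ_))
        (λ b r → plain _ r (apart (λ ()) p)) (λ b → apart λ ()) leaf-apart (touches (suc zero))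
    ... | no ¬p | no ¬q | yes r | _ =
      no-K24-with-plain-hub (plain zero ¬p ¬q) (m∈? ∘ (2 ↑ʳ_))
        (λ b → plain _ (apart (λ ()) r)) (λ b → apart λ ()) leaf-apart (touches zero)
    ... | no ¬p | no ¬q | no _ | yes r =
      no-K24-with-plain-hub (plain zero ¬p ¬q) (0∈? ∘ (2 ↑ʳ_))
        (λ b s → plain _ s (apart (λ ()) r)) (λ b → apart λ ()) leaf-apart (touches zero)
    ... | no ¬p | no ¬q | no ¬r | no ¬s =
      no-K24-with-plain-hubs (plain zero ¬p ¬q) (plain (suc zero) ¬r ¬s) (apart λ ())
        (0∈? ∘ (2 ↑ʳ_)) (m∈? ∘ (2 ↑ʳ_)) (connected ∘ (2 ↑ʳ_))
        (λ b → apart λ ()) (λ b → apart λ ()) leaf-apart (touches zero) (touches (suc zero))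

-- Embedding subdivisions into hosts

-- Unfolds to two successors, so that `double g`, `suc (double g)` and `double (suc g)` are
-- consecutive definitionally, as `up` and `down` require.
double : ℕ → ℕ
double zero    = zero
double (suc x) = suc (suc (double x))

double-injective : ∀ {x y} → double x ≡ double y → x ≡ y
double-injective {zero}  {zero}  _  = refl
double-injective {suc x} {suc y} eq = cong suc (double-injective (suc-injective (suc-injective eq)))

double≢suc-double : ∀ x y → double x ≢ suc (double y)
double≢suc-double (suc x) (suc y) eq = double≢suc-double x y (suc-injective (suc-injective eq))

double-mono : ∀ {x y} → x ≤ y → double x ≤ double y
double-mono z≤n     = z≤n
double-mono (s≤s p) = s≤s (s≤s (double-mono p))

double-mono-< : ∀ {x y} → x < y → suc (double x) < double y
double-mono-< = double-mono

module _ {n r s : ℕ} {plus : Bool} (F : EdgeSet n) where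

  -- Vertices of the subdivision are placed on positions of one parity of the
  -- host (v g), subdivision vertices on those of the other parity (e g).
  subdividable-by-placement :
    (m c : ℕ) (v e : ℕ → ℕ) (P : ℕ → ℕ → Set) (Q : ℕ → ℕ → ℕ → Set) →
    (∀ {g h} → v g ≡ v h → g ≡ h) → (∀ {g h} → e g ≡ e h → g ≡ h) → (∀ g h → v g ≢ e h) →
    (∀ (a : Fin n) → ∃ (P (toℕ a))) →
    (∀ (a b : Fin n) → F a b ≡ true → ∃ (Q (toℕ a) (toℕ b))) →
    (∀ {a g h} → P a g → P a h → g ≡ h) →
    (∀ {a b g} → P a g → P b g → a ≡ b) →
    (∀ {a b a′ b′ g} → Q a b g → Q a′ b′ g → a ≡ a′ × b ≡ b′) →
    (∀ (a b : Fin n) {g h} → BaseEdge n r s plus (toℕ a) (toℕ b) → F a b ≡ false →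
       P (toℕ a) g → P (toℕ b) h → HostAdj m c (v g) (v h)) →
    (∀ {a b g} → Q a b g → (∃ λ h → P a h × HostAdj m c (e g) (v h))
                         × (∃ λ h → P b h × HostAdj m c (e g) (v h))) →
    Subdividable n (GAdj n r s plus) F
  subdividable-by-placement m c v e P Q v-inj e-inj v≢e P-total Q-total P-fun P-inj Q-inj kept halves minor =
    host-K24MinorFree {m} {c} (minor-embedding f f-inj f-hom minor)
    where
    f : Fin n ⊎ SubVertex n F → ℕ
    f (inj₁ a)             = v (proj₁ (P-total a))
    f (inj₂ ((a , b) , p)) = e (proj₁ (Q-total a b p))
    f-inj : ∀ {x y} → f x ≡ f y → x ≡ y
    f-inj {inj₁ a} {inj₁ b} eq = cong inj₁ (Fin.toℕ-injective
      (P-inj (proj₂ (P-total a)) (subst (P (toℕ b)) (sym (v-inj eq)) (proj₂ (P-total b)))))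
    f-inj {inj₁ a} {inj₂ _} eq = ⊥-elim (v≢e _ _ eq)
    f-inj {inj₂ _} {inj₁ b} eq = ⊥-elim (v≢e _ _ (sym eq))
    f-inj {inj₂ ((a , b) , p)} {inj₂ ((a′ , b′) , p′)} eq
      with Q-inj (proj₂ (Q-total a b p)) (subst (Q (toℕ a′) (toℕ b′)) (sym (e-inj eq)) (proj₂ (Q-total a′ b′ p′)))
    ... | eq₁ , eq₂ with Fin.toℕ-injective {i = a} {a′} eq₁ | Fin.toℕ-injective {i = b} {b′} eq₂
    ...   | refl | refl = cong (λ q → inj₂ ((a , b) , q)) (UIP.Decidable⇒UIP.≡-irrelevant Bool._≟_ p p′)
    half : ∀ {a b} (p : F a b ≡ true) {x} → x ≡ a ⊎ x ≡ b →
           HostAdj m c (f (inj₂ ((a , b) , p))) (f (inj₁ x))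
    half {a} {b} p x≡ with halves (proj₂ (Q-total a b p)) | x≡
    ... | (_ , q , adj) , _ | inj₁ refl = subst (HostAdj m c _ ∘ v) (P-fun q (proj₂ (P-total a))) adj
    ... | _ , (_ , q , adj) | inj₂ refl = subst (HostAdj m c _ ∘ v) (P-fun q (proj₂ (P-total b))) adj
    f-hom : ∀ {x y} → SubAdj n (GAdj n r s plus) F x y → HostAdj m c (f x) (f y)
    f-hom {inj₁ a} {inj₁ b} (inj₁ ab , Fab , _) = kept a b ab Fab (proj₂ (P-total a)) (proj₂ (P-total b))
    f-hom {inj₁ a} {inj₁ b} (inj₂ ba , _ , Fba) =
      HostAdj-sym (kept b a ba Fba (proj₂ (P-total b)) (proj₂ (P-total a)))
    f-hom {inj₁ a} {inj₂ (_ , p)} x≡ = HostAdj-sym (half p x≡)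
    f-hom {inj₂ (_ , p)} {inj₁ a} x≡ = half p x≡

true≢false : ∀ {b} → b ≡ true → b ≢ false
true≢false refl ()

-- Position c is that of v_{s+1}: the chords of v_n end at indices up to s, those of v_1 at indices
-- n - 1 - i ≥ n - 1 - r ≥ s.
spine-subdividable : ∀ n r s plus (F : EdgeSet n) → r + s < n → F ≐ Spine →
                     Subdividable n (GAdj n r s plus) F
spine-subdividable (suc p) r s plus F (s≤s r+s≤p) F≐ =
  subdividable-by-placement F (double p) (double s) double (suc ∘ double) (λ a g → a ≡ g) Q
    double-injective (double-injective ∘ suc-injective) double≢suc-double
    (λ a → toℕ a , refl) Q-total (λ where refl refl → refl) (λ where refl refl → refl)
    (λ where (_ , refl , refl) (_ , refl , refl) → refl , refl) kept halves
  where
  Q : ℕ → ℕ → ℕ → Set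
  Q a b g = b ≤ p × b ≡ suc a × a ≡ g
  Q-total : ∀ a b → F a b ≡ true → ∃ (Q (toℕ a) (toℕ b))
  Q-total a b Fab = toℕ a , Fin.toℕ≤pred[n] b , Equivalence.to (F≐ a b) Fab , refl
  kept : ∀ (a b : Fin (suc p)) {g h} → BaseEdge (suc p) r s plus (toℕ a) (toℕ b) → F a b ≡ false →
         toℕ a ≡ g → toℕ b ≡ h → HostAdj (double p) (double s) (double g) (double h)
  kept a b (inj₁ spine) ¬Fab _ _ = ⊥-elim (true≢false (Equivalence.from (F≐ a b) spine) ¬Fab)
  kept a b (inj₂ (inj₁ (a≡0 , i , _ , i≤r , b≡p∸i))) _ refl refl rewrite a≡0 | b≡p∸i =
    from-start (double-mono (m+n≤o⇒m≤o∸n s (≤-trans (+-monoʳ-≤ s i≤r) (subst (_≤ p) (+-comm r s) r+s≤p))))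
               (double-mono (m∸n≤m p i))
  kept a b (inj₂ (inj₂ (inj₁ (b≡p , j , _ , j≤s , a≡j)))) _ refl refl rewrite b≡p | a≡j =
    to-end (double-mono j≤s) (double-mono (≤-trans j≤s (≤-trans (m≤n+m s r) r+s≤p)))
  kept a b (inj₂ (inj₂ (inj₂ (_ , a≡0 , b≡p)))) _ refl refl rewrite a≡0 | b≡p = to-end z≤n z≤n
  halves : ∀ {a b g} → Q a b g → (∃ λ h → a ≡ h × HostAdj (double p) (double s) (suc (double g)) (double h))
                               × (∃ λ h → b ≡ h × HostAdj (double p) (double s) (suc (double g)) (double h))
  halves (a<p , refl , refl) =
    (_ , refl , down (<-trans (n<1+n _) (double-mono-< a<p))) , (_ , refl , up (double-mono-< a<p))

-- The host is traversed as v_n, v_{n-1}, v_1, v_2, …, v_{n-2}.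
path2-subdividable : ∀ n s plus (F : EdgeSet n) → 3 ≤ n → s ≤ n ∸ 3 → F ≐ Path2 n →
                     Subdividable n (GAdj n 2 s plus) F
path2-subdividable (suc (suc (suc k))) s plus F (s≤s (s≤s (s≤s z≤n))) s≤k F≐ =
  -- Before doubling, 2 is the position of v_1. The start v_n has chords to v_1, ..., v_{n-2}; the
  -- end v_{n-2} has chords back to v_1 and v_{n-1}.
  subdividable-by-placement F (double (2 + k)) (double 2) double (suc ∘ double) P Q
    double-injective (double-injective ∘ suc-injective) double≢suc-double
    P-total Q-total P-fun P-inj Q-inj kept halves
  where
  data P : ℕ → ℕ → Set where
    inner : ∀ {a} → a ≤ k → P a (2 + a)
    apex  : P (1 + k) 1
    end   : P (2 + k) 0
  data Q : ℕ → ℕ → ℕ → Set where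
    inner : ∀ {a} → suc a ≤ k → Q a (suc a) (2 + a)
    apex  : Q 0 (1 + k) 1
    end   : Q (1 + k) (2 + k) 0
  place : ∀ a → a ≤ 2 + k → ∃ (P a)
  place a a≤2+k with m≤n⇒m<n∨m≡n a≤2+k
  ... | inj₂ refl = _ , end
  ... | inj₁ (s≤s a≤1+k) with m≤n⇒m<n∨m≡n a≤1+k
  ...   | inj₂ refl      = _ , apex
  ...   | inj₁ (s≤s a≤k) = _ , inner a≤k
  P-total : ∀ a → ∃ (P (toℕ a))
  P-total a = place (toℕ a) (Fin.toℕ≤pred[n] a)
  Q-total : ∀ a b → F a b ≡ true → ∃ (Q (toℕ a) (toℕ b))
  Q-total a b Fab with toℕ a | toℕ b | Equivalence.to (F≐ a b) Fab
  ... | _ | _ | inj₁ (refl , b≤k)         = _ , inner b≤k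
  ... | _ | _ | inj₂ (inj₁ (refl , refl)) = _ , apex
  ... | _ | _ | inj₂ (inj₂ (refl , refl)) = _ , end
  P-fun : ∀ {a g h} → P a g → P a h → g ≡ h
  P-fun (inner _) (inner _) = refl
  P-fun (inner p) apex      = ⊥-elim (1+n≰n p)
  P-fun (inner p) end       = ⊥-elim (1+n≰n (≤-trans (n≤1+n _) p))
  P-fun apex      (inner p) = ⊥-elim (1+n≰n p)
  P-fun apex      apex      = refl
  P-fun end       (inner p) = ⊥-elim (1+n≰n (≤-trans (n≤1+n _) p))
  P-fun end       end       = refl
  P-inj : ∀ {a b g} → P a g → P b g → a ≡ b
  P-inj (inner _) (inner _) = refl
  P-inj apex      apex      = refl
  P-inj end       end       = refl
  Q-inj : ∀ {a b a′ b′ g} → Q a b g → Q a′ b′ g → a ≡ a′ × b ≡ b′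
  Q-inj (inner _) (inner _) = refl , refl
  Q-inj apex      apex      = refl , refl
  Q-inj end       end       = refl , refl
  kept : ∀ (a b : Fin (3 + k)) {g h} → BaseEdge (3 + k) 2 s plus (toℕ a) (toℕ b) → F a b ≡ false →
         P (toℕ a) g → P (toℕ b) h → HostAdj (double (2 + k)) (double 2) (double g) (double h)
  kept a b e ¬Fab = route (λ path → true≢false (Equivalence.from (F≐ a b) path) ¬Fab) e
    where
    route : ∀ {a b g h} → ¬ Path2 (3 + k) a b → BaseEdge (3 + k) 2 s plus a b →
            P a g → P b h → HostAdj (double (2 + k)) (double 2) (double g) (double h)
    route ∉ (inj₁ refl) (inner _) (inner b≤k) = ⊥-elim (∉ (inj₁ (refl , b≤k)))
    route ∉ (inj₁ refl) (inner _) apex        = from-end (s≤s (s≤s z≤n)) (s≤s (s≤s z≤n))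
    route ∉ (inj₁ refl) (inner p) end         = ⊥-elim (1+n≰n p)
    route ∉ (inj₁ refl) apex      (inner p)   = ⊥-elim (1+n≰n (≤-trans (n≤1+n _) p))
    route ∉ (inj₁ refl) apex      end         = ⊥-elim (∉ (inj₂ (inj₂ (refl , refl))))
    route ∉ (inj₁ refl) end       (inner p)   = ⊥-elim (1+n≰n (≤-trans (n≤1+n _) (≤-trans (n≤1+n _) p)))
    route ∉ (inj₂ (inj₁ (refl , 0 , () , _)))
    route ∉ (inj₂ (inj₁ (refl , 1 , _ , _ , refl))) = ⊥-elim (∉ (inj₂ (inj₁ (refl , refl))))
    route ∉ (inj₂ (inj₁ (refl , 2 , _ , _ , refl))) p q with P-fun p (inner z≤n) | P-fun q (inner ≤-refl)
    ... | refl | refl = to-end ≤-refl (s≤s (s≤s (s≤s (s≤s z≤n))))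
    route ∉ (inj₂ (inj₁ (refl , suc (suc (suc _)) , _ , s≤s (s≤s ()) , _)))
    route ∉ (inj₂ (inj₂ (inj₁ (refl , j , _ , j≤s , refl)))) p q
      with P-fun p (inner (≤-trans j≤s s≤k)) | P-fun q end
    ... | refl | refl = to-start (s≤s (s≤s (s≤s (s≤s z≤n)))) (double-mono (s≤s (s≤s (≤-trans j≤s s≤k))))
    route ∉ (inj₂ (inj₂ (inj₂ (_ , refl , refl)))) p q with P-fun p (inner z≤n) | P-fun q end
    ... | refl | refl = to-start ≤-refl (s≤s (s≤s (s≤s (s≤s z≤n))))
  halves : ∀ {a b g} → Q a b g →
           (∃ λ h → P a h × HostAdj (double (2 + k)) (double 2) (suc (double g)) (double h))
         × (∃ λ h → P b h × HostAdj (double (2 + k)) (double 2) (suc (double g)) (double h))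
  halves (inner p) = (_ , inner (<⇒≤ p) , down (<-trans (n<1+n _) (double-mono-< (s≤s (s≤s p)))))
                   , (_ , inner p , up (double-mono-< (s≤s (s≤s p))))
  halves apex = (_ , inner z≤n , up (s≤s (s≤s (s≤s (s≤s z≤n))))) , (_ , apex , down (s≤s (s≤s (s≤s z≤n))))
  halves end  = (_ , apex , up (s≤s (s≤s z≤n))) , (_ , end , down (s≤s z≤n))

-- The subdivision vertex of v_{k+1} v_{k+2} (indices modulo n - 1 on the rim) is
-- the start of the host; then come v_{k+2}, …, v_{n-1}, v_1, …, v_{k+1} with the
-- remaining rim subdivision vertices in between, the subdivided spoke, and the hub.
rimSpoke-subdividable : ∀ k l (F : EdgeSet (2 + (k + l))) → F ≐ RimSpoke (2 + (k + l)) k →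
                        Subdividable (2 + (k + l)) (GAdj (2 + (k + l)) 1 (2 + (k + l) ∸ 3) true) F
rimSpoke-subdividable k l F F≐ =
  subdividable-by-placement F m c (suc ∘ double) double P Q
    (double-injective ∘ suc-injective) double-injective (λ g h → double≢suc-double h g ∘ sym)
    P-total Q-total P-fun P-inj Q-inj kept halves
  where
  n = 2 + (k + l)
  m = suc (double (suc (k + l)))
  -- This is v_{k+1}: the start needs it as the far end of its own rim edge, and all remaining
  -- spokes go to positions up to it.
  c = suc (double (k + l))
  data P : ℕ → ℕ → Set where
    before : ∀ {a} → a ≤ k → P a (a + l)
    after  : ∀ {j} → j < l → P (suc (k + j)) j
    hub    : P (suc (k + l)) (suc (k + l))
  data Q : ℕ → ℕ → ℕ → Set where
    before : ∀ {a} → a < k → Q a (suc a) (suc (a + l))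
    after  : ∀ {i} → i < l → Q (k + i) (suc (k + i)) i
    close  : Q 0 (k + l) l
    spoke  : Q k (suc (k + l)) (suc (k + l))
  rim-edge : ∀ a → a < k + l → ∃ (Q a (suc a))
  rim-edge a a<k+l with a <? k
  ... | yes a<k = _ , before a<k
  ... | no a≮k with m≤n⇒∃[o]m+o≡n (≮⇒≥ a≮k)
  ...   | i , refl = _ , after (+-cancelˡ-< k i l a<k+l)
  place : ∀ a → a ≤ suc (k + l) → ∃ (P a)
  place a a≤ with a ≤? k
  ... | yes a≤k = _ , before a≤k
  ... | no a≰k with m≤n⇒∃[o]m+o≡n (≰⇒> a≰k) | m≤n⇒m<n∨m≡n a≤
  ...   | j , refl | inj₁ (s≤s a<) = _ , after (+-cancelˡ-< k j l a<)
  ...   | j , refl | inj₂ eq = _ , subst (λ x → P x (suc (k + l))) (sym eq) hub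
  P-total : ∀ a → ∃ (P (toℕ a))
  P-total a = place (toℕ a) (Fin.toℕ≤pred[n] a)
  Q-total : ∀ a b → F a b ≡ true → ∃ (Q (toℕ a) (toℕ b))
  Q-total a b Fab with toℕ a | toℕ b | Equivalence.to (F≐ a b) Fab
  ... | a′ | _ | inj₁ (inj₁ (refl , b≤))    = rim-edge a′ b≤
  ... | _  | _ | inj₁ (inj₂ (refl , refl))  = _ , close
  ... | _  | _ | inj₂ (refl , refl)         = _ , spoke
  before≢after : ∀ {a j} → a ≡ suc (k + j) → a ≤ k → ⊥
  before≢after {j = j} refl a≤k = m+1+n≰m k (subst (_≤ k) (sym (+-suc k j)) a≤k)
  -- The primed versions take the equality of indices as an argument, since unification
  -- cannot split on equations between sums.
  P-fun′ : ∀ {a b g h} → a ≡ b → P a g → P b h → g ≡ h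
  P-fun′ eq (before _) (before _) = cong (_+ l) eq
  P-fun′ eq (before p) (after _) = ⊥-elim (before≢after eq p)
  P-fun′ eq (before p) hub = ⊥-elim (before≢after eq p)
  P-fun′ eq (after _) (before p) = ⊥-elim (before≢after (sym eq) p)
  P-fun′ eq (after _) (after _) = +-cancelˡ-≡ (suc k) _ _ eq
  P-fun′ eq (after p) hub = ⊥-elim (<⇒≢ p (+-cancelˡ-≡ (suc k) _ _ eq))
  P-fun′ eq hub (before p) = ⊥-elim (before≢after (sym eq) p)
  P-fun′ eq hub (after p) = ⊥-elim (<⇒≢ p (+-cancelˡ-≡ (suc k) _ _ (sym eq)))
  P-fun′ eq hub hub = refl
  P-fun : ∀ {a g h} → P a g → P a h → g ≡ h
  P-fun = P-fun′ refl
  P-inj′ : ∀ {a b g h} → g ≡ h → P a g → P b h → a ≡ b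
  P-inj′ eq (before _) (before _) = +-cancelʳ-≡ l _ _ eq
  P-inj′ eq (before _) (after j<l) = ⊥-elim (<⇒≱ j<l (subst (l ≤_) eq (m≤n+m l _)))
  P-inj′ eq (before a≤k) hub = ⊥-elim (1+n≰n (subst (_≤ k + l) eq (+-monoˡ-≤ l a≤k)))
  P-inj′ eq (after j<l) (before _) = ⊥-elim (<⇒≱ j<l (subst (l ≤_) (sym eq) (m≤n+m l _)))
  P-inj′ eq (after _) (after _) = cong (λ j → suc (k + j)) eq
  P-inj′ eq (after j<l) hub = ⊥-elim (<⇒≱ j<l (subst (l ≤_) (sym eq) (m≤n+m l (suc k))))
  P-inj′ eq hub (before a≤k) = ⊥-elim (1+n≰n (subst (_≤ k + l) (sym eq) (+-monoˡ-≤ l a≤k)))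
  P-inj′ eq hub (after j<l) = ⊥-elim (<⇒≱ j<l (subst (l ≤_) eq (m≤n+m l (suc k))))
  P-inj′ _ hub hub = refl
  P-inj : ∀ {a b g} → P a g → P b g → a ≡ b
  P-inj = P-inj′ refl
  Q-inj′ : ∀ {a b a′ b′ g h} → g ≡ h → Q a b g → Q a′ b′ h → a ≡ a′ × b ≡ b′
  Q-inj′ eq (before _) (before _) =
    let a≡a′ = +-cancelʳ-≡ l _ _ (suc-injective eq) in a≡a′ , cong suc a≡a′
  Q-inj′ eq (after _) (after _) = cong (k +_) eq , cong (λ i → suc (k + i)) eq
  Q-inj′ _ close close = refl , refl
  Q-inj′ _ spoke spoke = refl , refl
  Q-inj′ eq (before {a} _) (after i<l) = ⊥-elim (<⇒≱ i<l (subst (l ≤_) eq (m≤n+m l (suc a))))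
  Q-inj′ eq (before _) close = ⊥-elim (m≢1+n+m l (sym eq))
  Q-inj′ eq (before a<k) spoke = ⊥-elim (<⇒≢ a<k (+-cancelʳ-≡ l _ _ (suc-injective eq)))
  Q-inj′ eq (after i<l) (before {a} _) = ⊥-elim (<⇒≱ i<l (subst (l ≤_) (sym eq) (m≤n+m l (suc a))))
  Q-inj′ eq (after i<l) close = ⊥-elim (<⇒≢ i<l eq)
  Q-inj′ eq (after i<l) spoke = ⊥-elim (<⇒≱ i<l (subst (l ≤_) (sym eq) (m≤n+m l (suc k))))
  Q-inj′ eq close (before _) = ⊥-elim (m≢1+n+m l eq)
  Q-inj′ eq close (after i<l) = ⊥-elim (<⇒≢ i<l (sym eq))
  Q-inj′ eq close spoke = ⊥-elim (m≢1+n+m l eq)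
  Q-inj′ eq spoke (before a<k) = ⊥-elim (<⇒≢ a<k (+-cancelʳ-≡ l _ _ (suc-injective (sym eq))))
  Q-inj′ eq spoke (after i<l) = ⊥-elim (<⇒≱ i<l (subst (l ≤_) eq (m≤n+m l (suc k))))
  Q-inj′ eq spoke close = ⊥-elim (m≢1+n+m l (sym eq))
  Q-inj : ∀ {a b a′ b′ g} → Q a b g → Q a′ b′ g → a ≡ a′ × b ≡ b′
  Q-inj = Q-inj′ refl
  c≤m : c ≤ m
  c≤m = s≤s (≤-trans (n≤1+n _) (n≤1+n _))
  rim-position : ∀ {a g} → P a g → a ≤ k + l → g ≤ k + l
  rim-position (before a≤k) _ = +-monoˡ-≤ l a≤k
  rim-position (after j<l) _ = ≤-trans (<⇒≤ j<l) (m≤n+m l k)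
  rim-position hub a≤ = ⊥-elim (1+n≰n a≤)
  spoke-adj : ∀ {a b g h} → a ≤ k + l → b ≡ suc (k + l) → P a g → P b h →
              HostAdj m c (suc (double g)) (suc (double h))
  spoke-adj a≤ refl p q with P-fun q hub
  ... | refl = to-end g≤c (≤-trans g≤c c≤m)
    where g≤c = s≤s (double-mono (rim-position p a≤))
  kept : ∀ (a b : Fin n) {g h} → BaseEdge n 1 (n ∸ 3) true (toℕ a) (toℕ b) → F a b ≡ false →
         P (toℕ a) g → P (toℕ b) h → HostAdj m c (suc (double g)) (suc (double h))
  kept a b e ¬Fab = route (λ rim → true≢false (Equivalence.from (F≐ a b) rim) ¬Fab) (Fin.toℕ≤pred[n] b) e
    where
    route : ∀ {a b g h} → ¬ RimSpoke n k a b → b ≤ suc (k + l) → BaseEdge n 1 (n ∸ 3) true a b →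
            P a g → P b h → HostAdj m c (suc (double g)) (suc (double h))
    route ∉ b≤ (inj₁ refl) with m≤n⇒m<n∨m≡n b≤
    ... | inj₁ (s≤s b≤n-2) = ⊥-elim (∉ (inj₁ (inj₁ (refl , b≤n-2))))
    ... | inj₂ refl        = spoke-adj ≤-refl refl
    route ∉ _ (inj₂ (inj₁ (refl , 1 , _ , _ , refl))) = ⊥-elim (∉ (inj₁ (inj₂ (refl , refl))))
    route ∉ _ (inj₂ (inj₁ (refl , suc (suc _) , _ , s≤s () , _)))
    route ∉ _ (inj₂ (inj₂ (inj₁ (b≡ , j , _ , j≤ , refl)))) = spoke-adj (≤-trans j≤ (m∸n≤m (k + l) 1)) b≡
    route ∉ _ (inj₂ (inj₂ (inj₂ (_ , refl , b≡)))) = spoke-adj z≤n b≡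
  step-up : ∀ {g} → g ≤ suc (k + l) → HostAdj m c (double g) (suc (double g))
  step-up g≤ = up (s≤s (double-mono g≤))
  step-down : ∀ {g} → g ≤ k + l → HostAdj m c (double (suc g)) (suc (double g))
  step-down g≤ = down (s≤s (≤-trans (s≤s (double-mono g≤)) (n≤1+n _)))
  halves : ∀ {a b g} → Q a b g →
           (∃ λ h → P a h × HostAdj m c (double g) (suc (double h)))
         × (∃ λ h → P b h × HostAdj m c (double g) (suc (double h)))
  halves (before a<k) = (_ , before (<⇒≤ a<k) , step-down (+-monoˡ-≤ l (<⇒≤ a<k)))
                      , (_ , before a<k , step-up (m≤n⇒m≤1+n (+-monoˡ-≤ l a<k)))
  halves (after {zero} i<l) =
    (_ , subst (λ x → P x (k + l)) (sym (+-identityʳ k)) (before ≤-refl) , from-start ≤-refl c≤m)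
    , (_ , after i<l , step-up z≤n)
  halves (after {suc j} i<l) =
    (_ , subst (λ x → P x j) (sym (+-suc k j)) (after (<⇒≤ i<l)) , step-down (≤-trans (<⇒≤ (<⇒≤ i<l)) (m≤n+m l k)))
    , (_ , after i<l , step-up (m≤n⇒m≤1+n (≤-trans (<⇒≤ i<l) (m≤n+m l k))))
  halves close = (_ , before z≤n , step-up (m≤n⇒m≤1+n (m≤n+m l k))) , last l refl
    where
    -- For l = 0 the edge v_1v_{n-1} is itself the one at the start of the host, and v_{n-1} is
    -- v_{k+1}, reached by the chord to c.
    last : ∀ l′ → l′ ≡ l → ∃ λ h → P (k + l) h × HostAdj m c (double l) (suc (double h))
    last zero refl =
      _ , subst (λ x → P x (k + l)) (sym (+-identityʳ k)) (before ≤-refl) , from-start ≤-refl c≤m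
    last (suc j) refl = _ , subst (λ x → P x j) (sym (+-suc k j)) (after ≤-refl) , step-down (≤-trans (n≤1+n j) (m≤n+m l k))
  halves spoke = (_ , before ≤-refl , step-down ≤-refl) , (_ , hub , step-up ≤-refl)

-- Minors of subdivisions

_++ₚ_ : ∀ {G S x y z} → Path G S x y → Path G S y z → Path G S x z
here _     ++ₚ q = q
step s e p ++ₚ q = step s e (p ++ₚ q)

-- Sp b x y: the leaf b of the model is the subdivision vertex of the edge x y.
module SubdividedModel
  {n : ℕ} (A : Fin n → Fin n → Set) (F : EdgeSet n)
  (S : Fin 6 → Fin n → Set) (Sp : Fin 4 → Fin n → Fin n → Set)
  (disjoint : ∀ {i j x} → S i x → S j x → i ≡ j)
  (connected : ∀ i → Connected (FinGraph n A) (S i))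
  (Sp⇒F : ∀ {b x y} → Sp b x y → F x y ≡ true)
  (Sp⇒hubs : ∀ {b x y} → Sp b x y → (S zero x × S (suc zero) y) ⊎ (S (suc zero) x × S zero y))
  (Sp⇒empty : ∀ {b x y z} → Sp b x y → ¬ S (2 ↑ʳ b) z)
  (Sp-leaf : ∀ {b b′ x y} → Sp b x y → Sp b′ x y → b ≡ b′)
  (Sp-edge : ∀ {b x y x′ y′} → Sp b x y → Sp b x′ y′ → x ≡ x′ × y ≡ y′)
  (adjacent : ∀ (a : Fin 2) b → (∃ λ x → ∃ λ y → S (a ↑ˡ 4) x × S (2 ↑ʳ b) y × (A x y ⊎ A y x))
                              ⊎ (∃ λ x → ∃ λ y → Sp b x y))
  (A-sym : ∀ {x y} → A x y → A y x)
  where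

  G′ : Graph
  G′ = Subdivide n A F

  -- A subdivision vertex that is not a leaf joins the set of the first end of its edge.
  B : Fin 6 → V G′ → Set
  B i (inj₁ a)             = S i a
  B i (inj₂ ((x , y) , _)) = (∃ λ b → i ≡ 2 ↑ʳ b × Sp b x y) ⊎ ((∀ b → ¬ Sp b x y) × S i x)

  B-disjoint : ∀ i j w → B i w → B j w → i ≡ j
  B-disjoint i j (inj₁ _) p q = disjoint p q
  B-disjoint i j (inj₂ _) (inj₁ (b , refl , p)) (inj₁ (b′ , refl , q)) = cong (2 ↑ʳ_) (Sp-leaf p q)
  B-disjoint i j (inj₂ _) (inj₁ (b , _ , p)) (inj₂ (¬p , _)) = ⊥-elim (¬p b p)
  B-disjoint i j (inj₂ _) (inj₂ (¬p , _)) (inj₁ (b , _ , p)) = ⊥-elim (¬p b p)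
  B-disjoint i j (inj₂ _) (inj₂ (_ , p)) (inj₂ (_ , q)) = disjoint p q

  -- A special edge runs between the hubs, so an edge inside one branch set, or with an end in a
  -- leaf, is not special; its subdivision vertex was absorbed by its first end and may serve as a
  -- link.
  ends-differ : ∀ {i x y} → S i x → S i y → ∀ b → ¬ Sp b x y
  ends-differ p q b sp with Sp⇒hubs sp
  ... | inj₁ (p′ , q′) = case trans (disjoint p′ p) (disjoint q q′) of λ ()
  ... | inj₂ (p′ , q′) = case trans (disjoint p′ p) (disjoint q q′) of λ ()

  leaf-end-first : ∀ {b x y} → S (2 ↑ʳ b) x → ∀ b′ → ¬ Sp b′ x y
  leaf-end-first p b′ sp with Sp⇒hubs sp
  ... | inj₁ (q , _) = case disjoint p q of λ ()
  ... | inj₂ (q , _) = case disjoint p q of λ ()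

  leaf-end-second : ∀ {b x y} → S (2 ↑ʳ b) y → ∀ b′ → ¬ Sp b′ x y
  leaf-end-second p b′ sp with Sp⇒hubs sp
  ... | inj₁ (_ , q) = case disjoint p q of λ ()
  ... | inj₂ (_ , q) = case disjoint p q of λ ()

  lift-path : ∀ {i x y} → Path (FinGraph n A) (S i) x y → Path G′ (B i) (inj₁ x) (inj₁ y)
  lift-path (here p) = here p
  lift-path (step {x} {y} p e q) with F x y in Fxy | F y x in Fyx
  ... | true  | _     = step {y = inj₂ ((x , y) , Fxy)} p (inj₁ refl)
                          (step (inj₂ (ends-differ p (source∈ q) , p)) (inj₂ refl) (lift-path q))
  ... | false | true  = step {y = inj₂ ((y , x) , Fyx)} p (inj₂ refl)
                          (step (inj₂ (ends-differ (source∈ q) p , source∈ q)) (inj₁ refl) (lift-path q))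
  ... | false | false = step p (e , Fxy , Fyx) (lift-path q)

  B-connected : ∀ i → Connected G′ (B i)
  B-connected i (inj₁ x) (inj₁ y) p q = lift-path (connected i x y p q)
  B-connected i (inj₁ x) (inj₂ ((y , z) , Fyz)) p (inj₁ (b , refl , sp)) = ⊥-elim (Sp⇒empty sp p)
  B-connected i (inj₁ x) (inj₂ ((y , z) , Fyz)) p (inj₂ (¬sp , q)) =
    lift-path (connected i x y p q) ++ₚ step q (inj₁ refl) (here (inj₂ (¬sp , q)))
  B-connected i (inj₂ _) (inj₁ x) (inj₁ (b , refl , sp)) q = ⊥-elim (Sp⇒empty sp q)
  B-connected i (inj₂ ((x , _) , _)) (inj₁ y) (inj₂ (¬sp , p)) q =
    step (inj₂ (¬sp , p)) (inj₁ refl) (lift-path (connected i x y p q))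
  B-connected i (inj₂ (_ , f)) (inj₂ (_ , f′)) (inj₁ (b , refl , sp)) (inj₁ (b′ , eq , sp′))
    with Fin.↑ʳ-injective 2 b b′ eq
  ... | refl with Sp-edge sp sp′
  ...   | refl , refl = subst (λ g → Path G′ _ _ (inj₂ (_ , g)))
                          (UIP.Decidable⇒UIP.≡-irrelevant Bool._≟_ f f′) (here (inj₁ (b , refl , sp)))
  B-connected i (inj₂ _) (inj₂ _) (inj₁ (b , refl , sp)) (inj₂ (_ , q)) = ⊥-elim (Sp⇒empty sp q)
  B-connected i (inj₂ _) (inj₂ _) (inj₂ (_ , p)) (inj₁ (b , refl , sp)) = ⊥-elim (Sp⇒empty sp p)
  B-connected i (inj₂ ((x , _) , _)) (inj₂ ((y , _) , _)) (inj₂ (¬sp , p)) (inj₂ (¬sp′ , q)) =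
    step (inj₂ (¬sp , p)) (inj₁ refl)
      (lift-path (connected i x y p q) ++ₚ step q (inj₁ refl) (here (inj₂ (¬sp′ , q))))

  B-adjacent : ∀ (a : Fin 2) (b : Fin 4) → Σ (V G′) λ x → Σ (V G′) λ y →
               B (a ↑ˡ 4) x × B (2 ↑ʳ b) y × Adj G′ x y
  B-adjacent a b with adjacent a b
  ... | inj₁ (x , y , p , q , e) with F x y in Fxy | F y x in Fyx
  -- The subdivision vertex lies in the hub when x is its first end, and in the leaf when y is;
  -- either way it touches the other set.
  ...   | true  | _     = inj₂ ((x , y) , Fxy) , inj₁ y , inj₂ (leaf-end-second q , p) , q , inj₂ refl
  ...   | false | true  = inj₁ x , inj₂ ((y , x) , Fyx) , p , inj₂ (leaf-end-first q , q) , inj₂ refl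
  ...   | false | false = inj₁ x , inj₁ y , p , q , [ id , A-sym ]′ e , Fxy , Fyx
  B-adjacent a b | inj₂ (x , y , sp) = hub a (Sp⇒hubs sp)
    where
    w = inj₂ ((x , y) , Sp⇒F sp)
    w∈ : B (2 ↑ʳ b) w
    w∈ = inj₁ (b , refl , sp)
    hub : ∀ a → _ → Σ (V G′) λ x → Σ (V G′) λ y → B (a ↑ˡ 4) x × B (2 ↑ʳ b) y × Adj G′ x y
    hub zero       (inj₁ (p , _)) = inj₁ x , w , p , w∈ , inj₁ refl
    hub zero       (inj₂ (_ , q)) = inj₁ y , w , q , w∈ , inj₂ refl
    hub (suc zero) (inj₁ (_ , q)) = inj₁ y , w , q , w∈ , inj₂ refl
    hub (suc zero) (inj₂ (p , _)) = inj₁ x , w , p , w∈ , inj₁ refl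

  B-inhabited : ∀ i → ∃ (B i)
  B-inhabited zero       = let x , _ , p , _ = B-adjacent zero zero in x , p
  B-inhabited (suc zero) = let x , _ , p , _ = B-adjacent (suc zero) zero in x , p
  B-inhabited (suc (suc b)) = let _ , y , _ , q , _ = B-adjacent zero b in y , q

  K24-minor : HasK24Minor G′
  K24-minor = B , B-inhabited , B-disjoint , B-connected , B-adjacent

-- Blueprints of minors with affine coordinates

-- (c , p , q) stands for c, plus u if p, plus t if q.
Affine : Set
Affine = ℕ × Bool × Bool

sucᵃ : Affine → Affine
sucᵃ (c , v) = suc c , v

data _⇒ᵇ_ : Bool → Bool → Set where
  false⇒ : ∀ {b} → false ⇒ᵇ b
  true⇒  : true ⇒ᵇ true

_⇒ᵇ?_ : ∀ p q → Dec (p ⇒ᵇ q)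
false ⇒ᵇ? _     = yes false⇒
true  ⇒ᵇ? true  = yes true⇒
true  ⇒ᵇ? false = no λ ()

-- Coefficientwise comparison: sound for all values of u and t.
_≼_ : Affine → Affine → Set
(c , p , q) ≼ (c′ , p′ , q′) = c ≤ c′ × p ⇒ᵇ p′ × q ⇒ᵇ q′

_≼?_ : ∀ x y → Dec (x ≼ y)
(c , p , q) ≼? (c′ , p′ , q′) = c ≤? c′ ×-dec p ⇒ᵇ? p′ ×-dec q ⇒ᵇ? q′

_≈ᵃ_ : Affine → Affine → Set
x ≈ᵃ y = x ≼ y × y ≼ x

_≈ᵃ?_ : ∀ x y → Dec (x ≈ᵃ y)
x ≈ᵃ? y = x ≼? y ×-dec y ≼? x

0ᵃ : Affine
0ᵃ = 0 , false , false

-- The path of a graph on N vertices is cut into m segments labelled 0 and 1 (hubs)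
-- and 2 to 5 (leaves). A special (b , k , l) is a leaf b that subdivides an edge from
-- segment k to segment l. Indices are 0-based: vertex 0 is known to be adjacent to
-- L, …, N - 2, vertex N - 1 to 1, …, U, and the two to each other if chord is true.
record Blueprint (w : ℕ) : Set where
  constructor blueprint
  field
    N L U    : Affine
    chord    : Bool
    {m}      : ℕ
    cuts     : Vec Affine (suc m)
    labels   : Vec (Fin 6) m
    edges    : List (Affine × Affine)
    specials : Vec (Fin 4 × Fin m × Fin m) w

  Edge : Affine → Affine → Set
  Edge x y = (y ≈ᵃ sucᵃ x)
           ⊎ (x ≈ᵃ 0ᵃ × L ≼ y × sucᵃ (sucᵃ y) ≼ N)
           ⊎ (sucᵃ y ≈ᵃ N × sucᵃ 0ᵃ ≼ x × x ≼ U)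
           ⊎ (chord ≡ true × x ≈ᵃ 0ᵃ × sucᵃ y ≈ᵃ N)

  edge? : ∀ x y → Dec (Edge x y)
  edge? x y = y ≈ᵃ? sucᵃ x
        ⊎-dec (x ≈ᵃ? 0ᵃ ×-dec L ≼? y ×-dec sucᵃ (sucᵃ y) ≼? N)
        ⊎-dec (sucᵃ y ≈ᵃ? N ×-dec sucᵃ 0ᵃ ≼? x ×-dec x ≼? U)
        ⊎-dec (chord Bool.≟ true ×-dec x ≈ᵃ? 0ᵃ ×-dec sucᵃ y ≈ᵃ? N)

  lo hi : Fin m → Affine
  lo k = lookup cuts (inject₁ k)
  hi k = lookup cuts (suc k)

  label : Fin m → Fin 6
  label = lookup labels

  Joined : Fin m → Fin m → Affine × Affine → Set
  Joined k l (x , y) = (lo k ≼ x × sucᵃ x ≼ hi k) × (lo l ≼ y × sucᵃ y ≼ hi l) × Edge x y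

  Linked : Fin m → Fin m → Set
  Linked k l = (hi k ≈ᵃ lo l) ⊎ Any (Joined k l) edges

  linked? : ∀ k l → Dec (Linked k l)
  linked? k l = hi k ≈ᵃ? lo l ⊎-dec Any.any? (λ (x , y) →
    (lo k ≼? x ×-dec sucᵃ x ≼? hi k) ×-dec (lo l ≼? y ×-dec sucᵃ y ≼? hi l) ×-dec edge? x y) edges

  HubPair : Fin 6 → Fin 6 → Set
  HubPair i j = (i ≡ zero × j ≡ suc zero) ⊎ (i ≡ suc zero × j ≡ zero)

  spLeaf : Fin w → Fin 4
  spLeaf i = proj₁ (lookup specials i)

  spFrom spTo : Fin w → Fin m
  spFrom i = proj₁ (proj₂ (lookup specials i))
  spTo   i = proj₂ (proj₂ (lookup specials i))

  -- `SetsConnected` asks for a direct link between any two segments with one label; this suffices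
  -- because no branch set below has more than two segments.
  Ordered Bounded SetsConnected LeavesAdjacent SpecialsValid Valid : Set
  Ordered        = ∀ k l → toℕ k < toℕ l → hi k ≼ lo l
  Bounded        = ∀ k → sucᵃ (lo k) ≼ hi k × hi k ≼ N
  SetsConnected  = ∀ k l → label k ≡ label l → k ≡ l ⊎ Linked k l ⊎ Linked l k
  LeavesAdjacent = ∀ (a : Fin 2) (b : Fin 4) →
    (∃ λ k → ∃ λ l → label k ≡ a ↑ˡ 4 × label l ≡ 2 ↑ʳ b × (Linked k l ⊎ Linked l k))
    ⊎ (∃ λ i → b ≡ spLeaf i)
  SpecialsValid  = ∀ i → HubPair (label (spFrom i)) (label (spTo i))
    × (∀ k → label k ≢ 2 ↑ʳ spLeaf i) × (∀ j → spLeaf i ≡ spLeaf j → i ≡ j)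
  Valid = Ordered × Bounded × SetsConnected × LeavesAdjacent × SpecialsValid

  -- Validity mentions coefficients only, never u or t, so for a concrete blueprint this evaluates
  -- to `yes` once and for all.
  valid? : Dec Valid
  valid? =
    Fin.all? (λ k → Fin.all? λ l → toℕ k <? toℕ l →-dec hi k ≼? lo l)
    ×-dec Fin.all? (λ k → sucᵃ (lo k) ≼? hi k ×-dec hi k ≼? N)
    ×-dec Fin.all? (λ k → Fin.all? λ l → label k Fin.≟ label l →-dec
      (k Fin.≟ l ⊎-dec linked? k l ⊎-dec linked? l k))
    ×-dec Fin.all? (λ a → Fin.all? λ b →
      Fin.any? (λ k → Fin.any? λ l → label k Fin.≟ a ↑ˡ 4 ×-dec label l Fin.≟ 2 ↑ʳ b ×-dec
        (linked? k l ⊎-dec linked? l k))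
      ⊎-dec Fin.any? λ i → b Fin.≟ spLeaf i)
    ×-dec Fin.all? (λ i →
      ((label (spFrom i) Fin.≟ zero ×-dec label (spTo i) Fin.≟ suc zero)
       ⊎-dec (label (spFrom i) Fin.≟ suc zero ×-dec label (spTo i) Fin.≟ zero))
      ×-dec Fin.all? (λ k → ¬? (label k Fin.≟ 2 ↑ʳ spLeaf i))
      ×-dec Fin.all? (λ j → spLeaf i Fin.≟ spLeaf j →-dec i Fin.≟ j))

-- Soundness of blueprints

module AffineModel (u t : ℕ) where

  part : Bool → Bool → ℕ
  part false false = 0
  part true  false = u
  part false true  = t
  part true  true  = u + t

  ⟦_⟧ : Affine → ℕ
  ⟦ c , false , false ⟧ = c
  ⟦ c , true  , false ⟧ = c + u
  ⟦ c , false , true  ⟧ = c + t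
  ⟦ c , true  , true  ⟧ = c + (u + t)

  ⟦⟧-part : ∀ c p q → ⟦ c , p , q ⟧ ≡ c + part p q
  ⟦⟧-part c false false = sym (+-identityʳ c)
  ⟦⟧-part c false true  = refl
  ⟦⟧-part c true  false = refl
  ⟦⟧-part c true  true  = refl

  part-mono : ∀ {p q p′ q′} → p ⇒ᵇ p′ → q ⇒ᵇ q′ → part p q ≤ part p′ q′
  part-mono false⇒ false⇒ = z≤n
  part-mono {p′ = false} false⇒ true⇒ = ≤-refl
  part-mono {p′ = true}  false⇒ true⇒ = m≤n+m t u
  part-mono {q′ = false} true⇒ false⇒ = ≤-refl
  part-mono {q′ = true}  true⇒ false⇒ = m≤m+n u t
  part-mono true⇒ true⇒ = ≤-refl

  ≼-sound : ∀ x y → x ≼ y → ⟦ x ⟧ ≤ ⟦ y ⟧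
  ≼-sound (c , p , q) (c′ , p′ , q′) (c≤ , p⇒ , q⇒)
    rewrite ⟦⟧-part c p q | ⟦⟧-part c′ p′ q′ = +-mono-≤ c≤ (part-mono p⇒ q⇒)

  ≈-sound : ∀ x y → x ≈ᵃ y → ⟦ x ⟧ ≡ ⟦ y ⟧
  ≈-sound x y (p , q) = ≤-antisym (≼-sound x y p) (≼-sound y x q)

  suc-sound : ∀ x → ⟦ sucᵃ x ⟧ ≡ suc ⟦ x ⟧
  suc-sound (c , p , q) rewrite ⟦⟧-part (suc c) p q | ⟦⟧-part c p q = refl

  ≺-sound : ∀ x y → sucᵃ x ≼ y → ⟦ x ⟧ < ⟦ y ⟧
  ≺-sound x y p = subst (_≤ ⟦ y ⟧) (suc-sound x) (≼-sound (sucᵃ x) y p)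

  module _ {w : ℕ} (plan : Blueprint w) where

    open Blueprint plan

    -- The first hypothesis says N - 1 - L ≤ r, so each index y from L to N - 2 is reached by the
    -- chord of v_1 with i = N - 1 - y.
    edge-sound : ∀ {r s plus} → ⟦ N ⟧ ≤ suc (r + ⟦ L ⟧) → ⟦ U ⟧ ≤ s → (chord ≡ true → plus ≡ true) →
                 ∀ x y → Edge x y → BaseEdge ⟦ N ⟧ r s plus ⟦ x ⟧ ⟦ y ⟧
    edge-sound _ _ _ x y (inj₁ p) = inj₁ (trans (≈-sound y (sucᵃ x) p) (suc-sound x))
    edge-sound {r} N≤ _ _ x y (inj₂ (inj₁ (x≈0 , L≼y , p))) =
      inj₂ (inj₁ (≈-sound x 0ᵃ x≈0 , ⟦ N ⟧ ∸ 1 ∸ ⟦ y ⟧ , m<n⇒0<n∸m y<N-1 , i≤r ,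
        sym (m∸[m∸n]≡n (<⇒≤ y<N-1))))
      where
      y<N-1 : ⟦ y ⟧ < ⟦ N ⟧ ∸ 1
      y<N-1 = ∸-monoˡ-≤ 1 (subst (λ z → suc z ≤ ⟦ N ⟧) (suc-sound y) (≺-sound (sucᵃ y) N p))
      i≤r : ⟦ N ⟧ ∸ 1 ∸ ⟦ y ⟧ ≤ r
      i≤r = m≤n+o⇒m∸n≤o _ ⟦ y ⟧ (≤-trans (∸-monoˡ-≤ 1 N≤)
        (subst (r + ⟦ L ⟧ ≤_) (+-comm r ⟦ y ⟧) (+-monoʳ-≤ r (≼-sound L y L≼y))))
    edge-sound _ U≤s _ x y (inj₂ (inj₂ (inj₁ (p , 1≼x , x≼U)))) =
      inj₂ (inj₂ (inj₁ (cong (_∸ 1) (trans (sym (suc-sound y)) (≈-sound (sucᵃ y) N p)) ,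
        ⟦ x ⟧ , ≼-sound (sucᵃ 0ᵃ) x 1≼x , ≤-trans (≼-sound x U x≼U) U≤s , refl)))
    edge-sound _ _ e⇒plus x y (inj₂ (inj₂ (inj₂ (e≡ , x≈0 , p)))) =
      inj₂ (inj₂ (inj₂ (e⇒plus e≡ , ≈-sound x 0ᵃ x≈0 ,
        cong (_∸ 1) (trans (sym (suc-sound y)) (≈-sound (sucᵃ y) N p)))))

    Segment : Fin m → ℕ → Set
    Segment k x = ⟦ lo k ⟧ ≤ x × x < ⟦ hi k ⟧

    module _ {r s : ℕ} {plus : Bool} (N≤ : ⟦ N ⟧ ≤ suc (r + ⟦ L ⟧)) (U≤s : ⟦ U ⟧ ≤ s)
             (e⇒plus : chord ≡ true → plus ≡ true) (F : EdgeSet ⟦ N ⟧)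
             (sp : Fin w → Fin ⟦ N ⟧ × Fin ⟦ N ⟧) (sp-injective : ∀ i j → sp i ≡ sp j → i ≡ j)
             (sp∈ : ∀ i → Segment (spFrom i) (toℕ (proj₁ (sp i))) × Segment (spTo i) (toℕ (proj₂ (sp i)))
                        × F (proj₁ (sp i)) (proj₂ (sp i)) ≡ true)
             (valid : Valid) where

      n : ℕ
      n = ⟦ N ⟧

      A : Fin n → Fin n → Set
      A = GAdj n r s plus

      S : Fin 6 → Fin n → Set
      S i x = ∃ λ k → Segment k (toℕ x) × label k ≡ i

      Sp : Fin 4 → Fin n → Fin n → Set
      Sp b x y = ∃ λ i → b ≡ spLeaf i × (x , y) ≡ sp i

      ordered : Ordered
      ordered = proj₁ valid

      bounded : Bounded
      bounded = proj₁ (proj₂ valid)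

      segment-unique : ∀ {k l x} → Segment k x → Segment l x → k ≡ l
      segment-unique {k} {l} (k≤ , <k) (l≤ , <l) with Fin.<-cmp k l
      ... | tri< k<l _ _ = ⊥-elim (<⇒≱ <k (≤-trans (≼-sound _ _ (ordered k l k<l)) l≤))
      ... | tri≈ _ k≡l _ = k≡l
      ... | tri> _ _ l<k = ⊥-elim (<⇒≱ <l (≤-trans (≼-sound _ _ (ordered l k l<k)) k≤))

      segment-<n : ∀ {k x} → Segment k x → x < n
      segment-<n {k} (_ , <k) = ≤-trans <k (≼-sound _ _ (proj₂ (bounded k)))

      S-disjoint : ∀ {i j x} → S i x → S j x → i ≡ j
      S-disjoint (k , p , refl) (l , q , refl) = cong label (segment-unique p q)

      edge-between : ∀ {k l x y} → Segment k x → Segment l y → BaseEdge n r s plus x y →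
                     ∃ λ a → ∃ λ b → Segment k (toℕ a) × Segment l (toℕ b) × A a b
      edge-between {k} {l} p q e = fromℕ< (segment-<n p) , fromℕ< (segment-<n q) ,
        subst (Segment k) (sym (Fin.toℕ-fromℕ< _)) p , subst (Segment l) (sym (Fin.toℕ-fromℕ< _)) q ,
        inj₁ (subst₂ (BaseEdge n r s plus) (sym (Fin.toℕ-fromℕ< _)) (sym (Fin.toℕ-fromℕ< _)) e)

      linked-sound : ∀ {k l} → Linked k l →
                     ∃ λ a → ∃ λ b → Segment k (toℕ a) × Segment l (toℕ b) × A a b
      linked-sound {k} {l} (inj₁ hi≈lo) = consecutive ⟦ hi k ⟧ refl
        where
        consecutive : ∀ h → h ≡ ⟦ hi k ⟧ →
                      ∃ λ a → ∃ λ b → Segment k (toℕ a) × Segment l (toℕ b) × A a b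
        -- Segments are nonempty, so `hi k` is positive and its predecessor is the last vertex of
        -- segment k.
        consecutive zero eq =
          ⊥-elim (n≮0 (subst (⟦ lo k ⟧ <_) (sym eq) (≺-sound (lo k) (hi k) (proj₁ (bounded k)))))
        consecutive (suc h) eq = edge-between {k} {l}
          (s≤s⁻¹ (subst (⟦ lo k ⟧ <_) (sym eq) (≺-sound (lo k) (hi k) (proj₁ (bounded k)))) , subst (h <_) eq ≤-refl)
          (≤-reflexive lo≡ , subst (_< ⟦ hi l ⟧) lo≡ (≺-sound (lo l) (hi l) (proj₁ (bounded l))))
          (inj₁ refl)
          where
          lo≡ : ⟦ lo l ⟧ ≡ suc h
          lo≡ = trans (sym (≈-sound (hi k) (lo l) hi≈lo)) (sym eq)
      linked-sound {k} {l} (inj₂ any) with Any.satisfied any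
      ... | (x , y) , (p , p′) , (q , q′) , xy = edge-between {k} {l}
        (≼-sound _ _ p , ≺-sound x _ p′) (≼-sound _ _ q , ≺-sound y _ q′)
        (edge-sound {r} {s} {plus} N≤ U≤s e⇒plus x y xy)

      A-sym : ∀ {x y} → A x y → A y x
      A-sym (inj₁ p) = inj₂ p
      A-sym (inj₂ p) = inj₁ p

      ascend : ∀ {k} d (x y : Fin n) → toℕ x + d ≡ toℕ y → Segment k (toℕ x) → Segment k (toℕ y) →
               Path (FinGraph n A) (Segment k ∘ toℕ) x y
      ascend zero x y eq p q
        rewrite Fin.toℕ-injective {i = x} {y} (trans (sym (+-identityʳ _)) eq) = here q
      ascend {k} (suc d) x y eq p q =
        step p (inj₁ (inj₁ (Fin.toℕ-fromℕ< 1+x<n)))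
          (ascend {k} d x′ y (trans (cong (_+ d) (Fin.toℕ-fromℕ< 1+x<n)) 1+x+d≡y)
            (subst (Segment k) (sym (Fin.toℕ-fromℕ< 1+x<n))
              (m≤n⇒m≤1+n (proj₁ p) , ≤-<-trans 1+x≤y (proj₂ q))) q)
        where
        1+x+d≡y : suc (toℕ x) + d ≡ toℕ y
        1+x+d≡y = trans (sym (+-suc (toℕ x) d)) eq
        1+x≤y : suc (toℕ x) ≤ toℕ y
        1+x≤y = subst (suc (toℕ x) ≤_) 1+x+d≡y (m≤m+n _ d)
        1+x<n : suc (toℕ x) < n
        1+x<n = ≤-<-trans 1+x≤y (Fin.toℕ<n y)
        x′ : Fin n
        x′ = fromℕ< 1+x<n

      reverse : ∀ {T : Fin n → Set} {x y} → Path (FinGraph n A) T x y → Path (FinGraph n A) T y x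
      reverse (here p) = here p
      reverse (step p e q) = reverse q ++ₚ step (source∈ q) (A-sym e) (here p)

      segment-connected : ∀ k → Connected (FinGraph n A) (Segment k ∘ toℕ)
      segment-connected k x y p q with ≤-total (toℕ x) (toℕ y)
      ... | inj₁ x≤y = ascend {k} (toℕ y ∸ toℕ x) x y (m+[n∸m]≡n x≤y) p q
      ... | inj₂ y≤x = reverse (ascend {k} (toℕ x ∸ toℕ y) y x (m+[n∸m]≡n y≤x) q p)

      within : ∀ {k x y} → Path (FinGraph n A) (Segment k ∘ toℕ) x y →
               Path (FinGraph n A) (S (label k)) x y
      within = mapPath id (λ p → _ , p , refl) id

      S-connected : ∀ i → Connected (FinGraph n A) (S i)
      S-connected i x y (k , p , refl) (l , q , eq) with proj₁ (proj₂ (proj₂ valid)) k l (sym eq)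
      ... | inj₁ refl = within (segment-connected k x y p q)
      ... | inj₂ (inj₁ link) with linked-sound link
      ...   | a , b , p′ , q′ , ab =
        within (segment-connected k x a p p′) ++ₚ step (k , p′ , refl) ab
          (subst (λ j → Path (FinGraph n A) (S j) b y) eq (within (segment-connected l b y q′ q)))
      S-connected i x y (k , p , refl) (l , q , eq) | inj₂ (inj₂ link) with linked-sound link
      ...   | b , a , q′ , p′ , ba =
        within (segment-connected k x a p p′) ++ₚ step (k , p′ , refl) (A-sym ba)
          (subst (λ j → Path (FinGraph n A) (S j) b y) eq (within (segment-connected l b y q′ q)))

      S-adjacent : ∀ (a : Fin 2) b → (∃ λ x → ∃ λ y → S (a ↑ˡ 4) x × S (2 ↑ʳ b) y × (A x y ⊎ A y x))
                                   ⊎ (∃ λ x → ∃ λ y → Sp b x y)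
      S-adjacent a b with proj₁ (proj₂ (proj₂ (proj₂ valid))) a b
      ... | inj₂ (i , eq) = inj₂ (_ , _ , i , eq , refl)
      ... | inj₁ (k , l , p , q , inj₁ link) with linked-sound link
      ...   | x , y , x∈ , y∈ , xy = inj₁ (x , y , (k , x∈ , p) , (l , y∈ , q) , inj₁ xy)
      S-adjacent a b | inj₁ (k , l , p , q , inj₂ link) with linked-sound link
      ...   | y , x , y∈ , x∈ , yx = inj₁ (x , y , (k , x∈ , p) , (l , y∈ , q) , inj₂ yx)

      specialsValid : SpecialsValid
      specialsValid = proj₂ (proj₂ (proj₂ (proj₂ valid)))

      Sp⇒hubs : ∀ {b x y} → Sp b x y → (S zero x × S (suc zero) y) ⊎ (S (suc zero) x × S zero y)
      Sp⇒hubs (i , refl , refl) with sp∈ i | proj₁ (specialsValid i)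
      ... | p , q , _ | inj₁ (eq , eq′) = inj₁ ((_ , p , eq) , (_ , q , eq′))
      ... | p , q , _ | inj₂ (eq , eq′) = inj₂ ((_ , p , eq) , (_ , q , eq′))

      Sp-leaf : ∀ {b b′ x y} → Sp b x y → Sp b′ x y → b ≡ b′
      Sp-leaf (i , refl , eq) (j , refl , eq′) = cong spLeaf (sp-injective i j (trans (sym eq) eq′))

      Sp-edge : ∀ {b x y x′ y′} → Sp b x y → Sp b x′ y′ → x ≡ x′ × y ≡ y′
      Sp-edge (i , refl , refl) (j , eq , eq′) with proj₂ (proj₂ (specialsValid i)) j eq
      ... | refl = sym (cong proj₁ eq′) , sym (cong proj₂ eq′)

      segment-minor : HasK24Minor (Subdivide n A F)
      segment-minor = SubdividedModel.K24-minor A F S Sp S-disjoint S-connected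
        (λ where (i , refl , refl) → proj₂ (proj₂ (sp∈ i)))
        Sp⇒hubs
        (λ where (i , refl , _) (k , _ , eq) → proj₁ (proj₂ (specialsValid i)) k eq)
        Sp-leaf Sp-edge S-adjacent A-sym

  open Blueprint

  -- The ends of the subdivided edge may lie anywhere in their segments, so one blueprint treats a
  -- whole range of edges.
  single-edge-minor : (plan : Blueprint 1) {_ : True (valid? plan)} → ∀ {r s plus} →
    ⟦ N plan ⟧ ≤ suc (r + ⟦ L plan ⟧) → ⟦ U plan ⟧ ≤ s → (chord plan ≡ true → plus ≡ true) →
    ∀ F {a b} → Segment plan (spFrom plan zero) (toℕ a) → Segment plan (spTo plan zero) (toℕ b) →
    F a b ≡ true → HasK24Minor (Subdivide ⟦ N plan ⟧ (GAdj ⟦ N plan ⟧ r s plus) F)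
  single-edge-minor plan {valid} N≤ U≤s chord⇒plus F {a} {b} a∈ b∈ Fab =
    segment-minor plan N≤ U≤s chord⇒plus F (λ _ → a , b) (λ where zero zero _ → refl)
      (λ where zero → a∈ , b∈ , Fab) (toWitness valid)

  edge-pair-minor : (plan : Blueprint 2) {_ : True (valid? plan)} → ∀ {r s plus} →
    ⟦ N plan ⟧ ≤ suc (r + ⟦ L plan ⟧) → ⟦ U plan ⟧ ≤ s → (chord plan ≡ true → plus ≡ true) →
    ∀ F {a b c d} → a ≢ c →
    Segment plan (spFrom plan zero) (toℕ a) → Segment plan (spTo plan zero) (toℕ b) → F a b ≡ true →
    Segment plan (spFrom plan (suc zero)) (toℕ c) → Segment plan (spTo plan (suc zero)) (toℕ d) → F c d ≡ true →
    HasK24Minor (Subdivide ⟦ N plan ⟧ (GAdj ⟦ N plan ⟧ r s plus) F)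
  edge-pair-minor plan {valid} N≤ U≤s chord⇒plus F {a} {b} {c} {d} a≢c a∈ b∈ Fab c∈ d∈ Fcd =
    segment-minor plan N≤ U≤s chord⇒plus F sp sp-injective
      (λ where zero → a∈ , b∈ , Fab
               (suc zero) → c∈ , d∈ , Fcd) (toWitness valid)
    where
    sp : Fin 2 → _
    sp zero    = a , b
    sp (suc _) = c , d
    sp-injective : ∀ i j → sp i ≡ sp j → i ≡ j
    sp-injective zero zero _ = refl
    sp-injective zero (suc zero) eq = ⊥-elim (a≢c (cong proj₁ eq))
    sp-injective (suc zero) zero eq = ⊥-elim (a≢c (sym (cong proj₁ eq)))
    sp-injective (suc zero) (suc zero) _ = refl

  plain-minor : (plan : Blueprint 0) {_ : True (valid? plan)} → ∀ {r s plus} →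
    ⟦ N plan ⟧ ≤ suc (r + ⟦ L plan ⟧) → ⟦ U plan ⟧ ≤ s → (chord plan ≡ true → plus ≡ true) →
    HasK24Minor (GG ⟦ N plan ⟧ r s plus)
  plain-minor plan {valid} {r} {s} {plus} N≤ U≤s chord⇒plus = minor-embedding unsubdivide unsubdivide-injective unsubdivide-hom
    (segment-minor plan {r} {s} {plus} N≤ U≤s chord⇒plus none (λ ()) (λ ()) (λ ()) (toWitness valid))
    where
    none : EdgeSet ⟦ N plan ⟧
    none _ _ = false
    G′ = Subdivide ⟦ N plan ⟧ (GAdj ⟦ N plan ⟧ r s plus) none
    unsubdivide : V G′ → Fin ⟦ N plan ⟧
    unsubdivide (inj₁ a) = a
    unsubdivide-injective : ∀ {x y} → unsubdivide x ≡ unsubdivide y → x ≡ y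
    unsubdivide-injective {inj₁ _} {inj₁ _} = cong inj₁
    unsubdivide-hom : ∀ {x y} → Adj G′ x y → GAdj ⟦ N plan ⟧ r s plus (unsubdivide x) (unsubdivide y)
    unsubdivide-hom {inj₁ _} {inj₁ _} (e , _) = e

-- Subdivisions that have a K_{2,4} minor

κ u+ : ℕ → Affine
κ c  = c , false , false
u+ c = c , true , false

at : ∀ {x c} → x ≡ c → c ≤ x × x < suc c
at refl = ≤-refl , ≤-refl

-- With n = 6 + u (7 + u where N is u+ 7), v_k is index k - 1, so v_{n-i} is u+ (5 - i) (u+ (6 - i)).

v₁v_n-plan : Blueprint 1
v₁v_n-plan = blueprint (u+ 6) (u+ 3) (κ 2) true
  (κ 0 ∷ κ 1 ∷ κ 2 ∷ u+ 4 ∷ u+ 5 ∷ u+ 6 ∷ [])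
  (# 1 ∷ # 2 ∷ # 3 ∷ # 4 ∷ # 0 ∷ [])
  ((κ 0 , u+ 4) ∷ (κ 0 , u+ 3) ∷ (κ 1 , u+ 5) ∷ (κ 2 , u+ 5) ∷ [])
  ((# 3 , # 0 , # 4) ∷ [])

-- For chords of v_1 other than v_1v_{n-1}. Merging v_2 into the hub of v_1 links that hub to v_n
-- without the edge v_1v_n; the leaves are v_3, v_{n-1}, v_n and the subdivision vertex.
v₁-plan : Blueprint 1
v₁-plan = blueprint (u+ 6) (u+ 4) (κ 3) false
  (κ 0 ∷ κ 2 ∷ κ 3 ∷ u+ 4 ∷ u+ 5 ∷ u+ 6 ∷ [])
  (# 0 ∷ # 2 ∷ # 1 ∷ # 3 ∷ # 4 ∷ [])
  ((κ 0 , u+ 4) ∷ (κ 1 , u+ 5) ∷ (κ 3 , u+ 5) ∷ [])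
  ((# 3 , # 0 , # 2) ∷ [])

-- The second hub joins v_1 to v_4, ..., v_{n-2} along v_1v_{n-2}, leaving v_2, v_3 and v_{n-1} as
-- leaves. The next three plans move the leaves so that the subdivided edge may end nearer to v_1.
v_n-plan : Blueprint 1
v_n-plan = blueprint (u+ 6) (u+ 3) (κ 2) false
  (κ 0 ∷ κ 1 ∷ κ 2 ∷ κ 3 ∷ u+ 4 ∷ u+ 5 ∷ u+ 6 ∷ [])
  (# 1 ∷ # 2 ∷ # 3 ∷ # 1 ∷ # 4 ∷ # 0 ∷ [])
  ((κ 0 , u+ 3) ∷ (κ 1 , u+ 5) ∷ (κ 2 , u+ 5) ∷ [])
  ((# 3 , # 3 , # 5) ∷ [])

v_n-plan-chord : Blueprint 1
v_n-plan-chord = blueprint (u+ 6) (u+ 3) (κ 1) true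
  (κ 0 ∷ κ 1 ∷ κ 2 ∷ u+ 4 ∷ u+ 5 ∷ u+ 6 ∷ [])
  (# 2 ∷ # 3 ∷ # 1 ∷ # 4 ∷ # 0 ∷ [])
  ((κ 0 , u+ 3) ∷ (κ 0 , u+ 5) ∷ (κ 1 , u+ 5) ∷ [])
  ((# 3 , # 2 , # 4) ∷ [])

v_n-plan-low : Blueprint 1
v_n-plan-low = blueprint (u+ 6) (u+ 3) (u+ 2) false
  (κ 0 ∷ u+ 1 ∷ u+ 2 ∷ u+ 3 ∷ u+ 4 ∷ u+ 5 ∷ u+ 6 ∷ [])
  (# 1 ∷ # 2 ∷ # 3 ∷ # 1 ∷ # 4 ∷ # 0 ∷ [])
  ((κ 0 , u+ 3) ∷ (u+ 1 , u+ 5) ∷ (u+ 2 , u+ 5) ∷ [])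
  ((# 3 , # 0 , # 5) ∷ [])

v_n-plan-full : Blueprint 1
v_n-plan-full = blueprint (u+ 6) (u+ 3) (u+ 3) false
  (κ 0 ∷ u+ 2 ∷ u+ 3 ∷ u+ 4 ∷ u+ 5 ∷ u+ 6 ∷ [])
  (# 1 ∷ # 2 ∷ # 3 ∷ # 4 ∷ # 0 ∷ [])
  ((κ 0 , u+ 3) ∷ (κ 0 , u+ 4) ∷ (u+ 2 , u+ 5) ∷ (u+ 3 , u+ 5) ∷ [])
  ((# 3 , # 0 , # 4) ∷ [])

-- Here and in `v₁v_n-1-plan`, n ≥ 7 keeps a hub segment nonempty: v_5, ..., v_{n-2} here and v_3,
-- ..., v_{n-4} there.
v₂v_n-plan : Blueprint 1
v₂v_n-plan = blueprint (u+ 7) (u+ 4) (κ 3) false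
  (κ 0 ∷ κ 2 ∷ κ 3 ∷ κ 4 ∷ u+ 5 ∷ u+ 6 ∷ u+ 7 ∷ [])
  (# 1 ∷ # 2 ∷ # 3 ∷ # 1 ∷ # 4 ∷ # 0 ∷ [])
  ((κ 0 , u+ 4) ∷ (κ 2 , u+ 6) ∷ (κ 3 , u+ 6) ∷ [])
  ((# 3 , # 0 , # 5) ∷ [])

-- r ≥ 3 enters through the chord v_1v_{n-3}, which links the leaf v_1 to the hub v_3, ..., v_{n-3}.
v₃v_n-plan : Blueprint 1
v₃v_n-plan = blueprint (u+ 6) (u+ 2) (κ 1) false
  (κ 0 ∷ κ 1 ∷ κ 2 ∷ u+ 3 ∷ u+ 4 ∷ u+ 6 ∷ [])
  (# 2 ∷ # 3 ∷ # 1 ∷ # 4 ∷ # 0 ∷ [])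
  ((κ 0 , u+ 4) ∷ (κ 0 , u+ 2) ∷ (κ 1 , u+ 5) ∷ [])
  ((# 3 , # 2 , # 4) ∷ [])

v₁v_n-1-plan : Blueprint 1
v₁v_n-1-plan = blueprint (u+ 7) (u+ 3) (κ 2) false
  (κ 0 ∷ κ 1 ∷ κ 2 ∷ u+ 3 ∷ u+ 4 ∷ u+ 5 ∷ u+ 7 ∷ [])
  (# 0 ∷ # 2 ∷ # 1 ∷ # 3 ∷ # 4 ∷ # 1 ∷ [])
  ((κ 0 , u+ 3) ∷ (κ 0 , u+ 4) ∷ (κ 2 , u+ 6) ∷ [])
  ((# 3 , # 0 , # 5) ∷ [])

-- Why the two sets for r = 2 cannot be merged: subdividing v_1v_{n-1} and v_{n-2}v_{n-1} gives two
-- leaves between the hubs {v_1, v_{n-2}} and {v_{n-1}, v_n}, besides v_2 and the segment v_3, ...,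
-- v_{n-3}.
v_n-1-pair-plan : Blueprint 2
v_n-1-pair-plan = blueprint (u+ 6) (u+ 3) (κ 2) false
  (κ 0 ∷ κ 1 ∷ κ 2 ∷ u+ 3 ∷ u+ 4 ∷ u+ 6 ∷ [])
  (# 1 ∷ # 2 ∷ # 3 ∷ # 1 ∷ # 0 ∷ [])
  ((κ 0 , u+ 3) ∷ (κ 1 , u+ 5) ∷ (κ 2 , u+ 5) ∷ [])
  ((# 2 , # 0 , # 4) ∷ (# 3 , # 3 , # 4) ∷ [])

-- s = 3 + u and n = 6 + u + t: the leaves are v_{s-1}, …, v_{s+2}, the middle two being
-- adjacent to both ends.
twoCommonNeighbours-plan : Blueprint 0
twoCommonNeighbours-plan = blueprint (6 , true , true) (u+ 2) (u+ 3) false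
  (κ 0 ∷ u+ 1 ∷ u+ 2 ∷ u+ 3 ∷ u+ 4 ∷ u+ 5 ∷ (6 , true , true) ∷ [])
  (# 0 ∷ # 2 ∷ # 3 ∷ # 4 ∷ # 5 ∷ # 1 ∷ [])
  ((κ 0 , u+ 2) ∷ (κ 0 , u+ 3) ∷ (κ 0 , u+ 4) ∷
   (u+ 1 , n-1) ∷ (u+ 2 , n-1) ∷ (u+ 3 , n-1) ∷ [])
  []
  where n-1 = 5 , true , true

-- The hubs are v_n and an arc of the rim; the leaves are the two adjacent rim vertices outside the
-- arc and the two subdivided spokes. The plans differ in the pair left out.
spokes-plan-0,1 spokes-plan-1,2 spokes-plan-2,3 spokes-plan-end spokes-plan-wrap : Blueprint 2
spokes-plan-0,1 = blueprint (u+ 6) (u+ 4) (u+ 3) true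
  (κ 0 ∷ κ 1 ∷ κ 2 ∷ u+ 5 ∷ u+ 6 ∷ [])
  (# 2 ∷ # 3 ∷ # 1 ∷ # 0 ∷ [])
  ((κ 0 , u+ 4) ∷ (κ 0 , u+ 5) ∷ (κ 1 , u+ 5) ∷ [])
  ((# 2 , # 2 , # 3) ∷ (# 3 , # 2 , # 3) ∷ [])
spokes-plan-1,2 = blueprint (u+ 6) (u+ 4) (u+ 3) true
  (κ 0 ∷ κ 1 ∷ κ 2 ∷ κ 3 ∷ u+ 5 ∷ u+ 6 ∷ [])
  (# 1 ∷ # 2 ∷ # 3 ∷ # 1 ∷ # 0 ∷ [])
  ((κ 0 , u+ 4) ∷ (κ 1 , u+ 5) ∷ (κ 2 , u+ 5) ∷ [])
  ((# 2 , # 0 , # 4) ∷ (# 3 , # 3 , # 4) ∷ [])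
spokes-plan-2,3 = blueprint (u+ 6) (u+ 4) (u+ 3) true
  (κ 0 ∷ κ 2 ∷ κ 3 ∷ κ 4 ∷ u+ 5 ∷ u+ 6 ∷ [])
  (# 1 ∷ # 2 ∷ # 3 ∷ # 1 ∷ # 0 ∷ [])
  ((κ 0 , u+ 4) ∷ (κ 2 , u+ 5) ∷ (κ 3 , u+ 5) ∷ [])
  ((# 2 , # 0 , # 4) ∷ (# 3 , # 3 , # 4) ∷ [])
spokes-plan-end = blueprint (u+ 6) (u+ 4) (u+ 3) true
  (κ 0 ∷ u+ 3 ∷ u+ 4 ∷ u+ 5 ∷ u+ 6 ∷ [])
  (# 1 ∷ # 2 ∷ # 3 ∷ # 0 ∷ [])
  ((κ 0 , u+ 4) ∷ (u+ 3 , u+ 5) ∷ [])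
  ((# 2 , # 0 , # 3) ∷ (# 3 , # 0 , # 3) ∷ [])
spokes-plan-wrap = blueprint (u+ 6) (u+ 4) (u+ 3) true
  (κ 0 ∷ κ 1 ∷ u+ 4 ∷ u+ 5 ∷ u+ 6 ∷ [])
  (# 2 ∷ # 1 ∷ # 3 ∷ # 0 ∷ [])
  ((κ 0 , u+ 5) ∷ [])
  ((# 2 , # 1 , # 3) ∷ (# 3 , # 1 , # 3) ∷ [])

-- Consequences of 3-connectivity

-- `BaseEdge` without truncated subtraction and without the witnesses i and j, so that the cases can
-- be compared with segment bounds.
data EdgeView (n r s : ℕ) (plus : Bool) (a b : ℕ) : Set where
  spine  : b ≡ suc a → EdgeView n r s plus a b
  start  : a ≡ 0 → n ≤ suc (b + r) → suc (suc b) ≤ n → EdgeView n r s plus a b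
  finish : suc b ≡ n → 1 ≤ a → a ≤ s → EdgeView n r s plus a b
  chord  : plus ≡ true → a ≡ 0 → suc b ≡ n → EdgeView n r s plus a b

edgeView : ∀ {n r s plus a b} → 2 ≤ n → BaseEdge n r s plus a b → EdgeView n r s plus a b
edgeView _ (inj₁ b≡) = spine b≡
edgeView {suc zero} (s≤s ()) (inj₂ (inj₁ _))
edgeView {suc (suc n)} {r} _ (inj₂ (inj₁ (a≡0 , i , 1≤i , i≤r , refl))) =
  start a≡0 (s≤s (≤-trans (subst (suc n ≤_) (+-comm i _) (m≤n+m∸n (suc n) i)) (+-monoʳ-≤ (suc n ∸ i) i≤r)))
    (s≤s (s≤s (∸-monoʳ-≤ (suc n) 1≤i)))
edgeView {suc n} _ (inj₂ (inj₂ (inj₁ (refl , j , 1≤j , j≤s , refl)))) = finish refl 1≤j j≤s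
edgeView {suc n} _ (inj₂ (inj₂ (inj₂ (p , a≡0 , refl)))) = chord p a≡0 refl

orient : ∀ {n r s plus} {a b : Fin n} → 2 ≤ n → toℕ a < toℕ b → GAdj n r s plus a b →
         BaseEdge n r s plus (toℕ a) (toℕ b)
orient _   _   (inj₁ e) = e
orient {b = b} 2≤n a<b (inj₂ e) with edgeView 2≤n e
... | spine a≡         = ⊥-elim (<-asym a<b (≤-reflexive (sym a≡)))
... | start b≡0 _ _    = ⊥-elim (n≮0 (subst (_ <_) b≡0 a<b))
... | finish 1+a≡n _ _ = ⊥-elim (<⇒≱ a<b (s≤s⁻¹ (subst (toℕ b <_) (sym 1+a≡n) (Fin.toℕ<n b))))
... | chord _ b≡0 _    = ⊥-elim (n≮0 (subst (_ <_) b≡0 a<b))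

isolated : ∀ {G S x y} → (∀ {z} → Adj G x z → ¬ S z) → x ≢ y → ¬ Path G S x y
isolated alone x≢y (here _)     = x≢y refl
isolated alone x≢y (step _ e p) = alone e (source∈ p)

-- Otherwise v_{s+2} has no neighbours besides v_{s+1} and v_{s+3}.
threeConnected⇒degrees : ∀ u r s plus → s ≤ 3 + u → ThreeConnected (6 + u) (GAdj (6 + u) r s plus) →
                         4 + u ≤ r + s
threeConnected⇒degrees u r s plus s≤ (_ , conn) = ≮⇒≥ λ r+s< →
  isolated {FinGraph n A} {x = v} {y = proj₁ other} (alone r+s<) (proj₁ (proj₂ other) ∘ sym)
    (conn x y v (proj₁ other) (apart 1+n≢n v≡ x≡) (apart (1+n≢n ∘ sym) v≡ y≡)
      (proj₁ (proj₂ (proj₂ other))) (proj₂ (proj₂ (proj₂ other))))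
  where
  n : ℕ
  n = 6 + u
  A : Fin n → Fin n → Set
  A = GAdj n r s plus
  y<n : 2 + s < n
  y<n = s≤s (s≤s (s≤s s≤))
  v<n : suc s < n
  v<n = <-trans (n<1+n _) y<n
  x<n : s < n
  x<n = <-trans (n<1+n _) v<n
  x v y : Fin n
  x = fromℕ< x<n
  v = fromℕ< v<n
  y = fromℕ< y<n
  x≡ : toℕ x ≡ s
  x≡ = Fin.toℕ-fromℕ< x<n
  v≡ : toℕ v ≡ suc s
  v≡ = Fin.toℕ-fromℕ< v<n
  y≡ : toℕ y ≡ 2 + s
  y≡ = Fin.toℕ-fromℕ< y<n
  apart : ∀ {a b : Fin n} {k l} → k ≢ l → toℕ a ≡ k → toℕ b ≡ l → a ≢ b
  apart k≢l refl refl refl = k≢l refl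
  other : ∃ λ z → z ≢ v × z ≢ x × z ≢ y
  -- The indices s, s + 1 and s + 2 are taken; 0 is free unless s = 0, and then 3 is.
  other = away s refl
    where
    away : ∀ t → t ≡ s → ∃ λ z → z ≢ v × z ≢ x × z ≢ y
    away zero refl    = # 3 , apart (λ ()) refl v≡ , apart (λ ()) refl x≡ , apart (λ ()) refl y≡
    away (suc t) refl = # 0 , apart (λ ()) refl v≡ , apart (λ ()) refl x≡ , apart (λ ()) refl y≡
  alone : r + s < 4 + u → ∀ {z} → A v z → ¬ (z ≢ x × z ≢ y)
  alone r+s< {z} (inj₁ e) (z≢x , z≢y) with edgeView (s≤s (s≤s z≤n)) e
  ... | spine z≡      = z≢y (Fin.toℕ-injective (trans z≡ (trans (cong suc v≡) (sym y≡))))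
  ... | start v≡0 _ _ = case trans (sym v≡) v≡0 of λ ()
  ... | finish _ _ v≤s = 1+n≰n (subst (_≤ s) v≡ v≤s)
  ... | chord _ v≡0 _ = case trans (sym v≡) v≡0 of λ ()
  alone r+s< {z} (inj₂ e) (z≢x , z≢y) with edgeView (s≤s (s≤s z≤n)) e
  ... | spine v≡1+z  = z≢x (Fin.toℕ-injective (trans (suc-injective (trans (sym v≡1+z) v≡)) (sym x≡)))
  ... | start _ n≤ _ = <⇒≱ r+s< (s≤s⁻¹ (s≤s⁻¹
          (≤-trans n≤ (≤-reflexive (cong suc (trans (cong (_+ r) v≡) (cong suc (+-comm s r))))))))
  ... | finish 1+v≡n _ _ = n≢ 1+v≡n
    where
    n≢ : suc (toℕ v) ≢ n
    n≢ eq = 1+n≰n (≤-trans (≤-reflexive (suc-injective (suc-injective (trans (sym eq) (cong suc v≡))))) s≤)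
  ... | chord _ _ 1+v≡n =
    1+n≰n (≤-trans (≤-reflexive (suc-injective (suc-injective (trans (sym 1+v≡n) (cong suc v≡))))) s≤)

-- Otherwise v_1 has only two neighbours.
threeConnected⇒chord : ∀ u s plus → ThreeConnected (6 + u) (GAdj (6 + u) 1 s plus) → plus ≡ true
threeConnected⇒chord u s true  _          = refl
threeConnected⇒chord u s false (_ , conn) = ⊥-elim (isolated {FinGraph n A} alone (λ ())
  (conn (# 1) y (# 0) (# 2) (λ ()) (λ ()) (λ ()) 2≢y))
  where
  n : ℕ
  n = 6 + u
  A : Fin n → Fin n → Set
  A = GAdj n 1 s false
  y<n : 4 + u < n
  y<n = m≤n+m (5 + u) 1
  y : Fin n
  y = fromℕ< y<n
  y≡ : toℕ y ≡ 4 + u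
  y≡ = Fin.toℕ-fromℕ< y<n
  2≢y : # 2 ≢ y
  2≢y eq′ = case trans (cong toℕ eq′) y≡ of λ ()
  alone : ∀ {z} → A (# 0) z → ¬ (z ≢ # 1 × z ≢ y)
  alone (inj₁ (inj₁ z≡)) (z≢1 , _) = z≢1 (Fin.toℕ-injective z≡)
  alone (inj₁ (inj₂ (inj₁ (_ , 1 , _ , _ , z≡)))) (_ , z≢y) = z≢y (Fin.toℕ-injective (trans z≡ (sym y≡)))
  alone (inj₁ (inj₂ (inj₁ (_ , suc (suc _) , _ , s≤s () , _))))
  alone (inj₁ (inj₂ (inj₂ (inj₁ (_ , j , () , _ , refl)))))
  alone (inj₁ (inj₂ (inj₂ (inj₂ (() , _)))))
  alone (inj₂ (inj₂ (inj₁ (_ , 1 , _ , _ , ()))))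
  alone (inj₂ (inj₂ (inj₁ (_ , suc (suc _) , _ , s≤s () , _))))
  alone (inj₂ (inj₂ (inj₂ (inj₁ (() , _)))))
  alone (inj₂ (inj₂ (inj₂ (inj₂ (() , _)))))

-- Maximal sets from a covering antichain

does⇒ : ∀ {P : Set} (P? : Dec P) → does P? ≡ true → P
does⇒ (yes p) _ = p

-- Maximality among all subdividable sets, read off an antichain P of subdividable
-- sets that covers them all.
maximal⇔ : ∀ {n} {A : Fin n → Fin n → Set} {I : Set} (P : I → ℕ → ℕ → Set) →
  (∀ i a b → Dec (P i a b)) →
  (∀ i (a b : Fin n) → P i (toℕ a) (toℕ b) → toℕ a < toℕ b × A a b) →
  (∀ i F → F ≐ P i → Subdividable n A F) →
  (∀ F → IsEdgeSet n A F → Subdividable n A F →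
     ∃ λ i → ∀ a b → F a b ≡ true → P i (toℕ a) (toℕ b)) →
  (∀ i j → (∀ (a b : Fin n) → P i (toℕ a) (toℕ b) → P j (toℕ a) (toℕ b)) →
     ∀ (a b : Fin n) → P j (toℕ a) (toℕ b) → P i (toℕ a) (toℕ b)) →
  ∀ F → MaximalSubdividable n A F ⇔ (∃ λ i → F ≐ P i)
maximal⇔ {n} {A} {I} P P? P⇒edge P-subdividable cover antichain F = mk⇔ to from
  where
  indicator : I → EdgeSet n
  indicator i a b = does (P? i (toℕ a) (toℕ b))
  indicator≐ : ∀ i → indicator i ≐ P i
  indicator≐ i a b = mk⇔ (does⇒ (P? i _ _)) (dec-true (P? i _ _))
  to : MaximalSubdividable n A F → ∃ λ i → F ≐ P i
  to (edges , subdividable , maximal) with cover F edges subdividable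
  ... | i , F⊆P = i , λ a b → mk⇔ (F⊆P a b) λ p →
    maximal (indicator i) (λ a b q → P⇒edge i a b (does⇒ (P? i _ _) q))
      (λ a b q → dec-true (P? i _ _) (F⊆P a b q))
      (P-subdividable i (indicator i) (indicator≐ i)) a b (dec-true (P? i _ _) p)
  from : (∃ λ i → F ≐ P i) → MaximalSubdividable n A F
  from (i , F≐) = (λ a b p → P⇒edge i a b (Equivalence.to (F≐ a b) p)) , P-subdividable i F F≐ , maximal
    where
    maximal : ∀ F′ → IsEdgeSet n A F′ → F ⊆ₑ F′ → Subdividable n A F′ → F′ ⊆ₑ F
    maximal F′ edges F⊆F′ subdividable a b p with cover F′ edges subdividable
    ... | j , F′⊆P = Equivalence.from (F≐ a b)
      (antichain i j (λ a b q → F′⊆P a b (F⊆F′ a b (Equivalence.from (F≐ a b) q))) a b (F′⊆P a b p))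

spine-edge : ∀ {n r s plus} (a b : Fin n) → Spine (toℕ a) (toℕ b) →
             toℕ a < toℕ b × GAdj n r s plus a b
spine-edge a b eq = ≤-reflexive (sym eq) , inj₁ (inj₁ eq)

spine? : ∀ a b → Dec (Spine a b)
spine? a b = b ≟ suc a

-- Matching on this turns `6 + u` into `7 + u′` definitionally, as the plans for n ≥ 7 require.
data Positive : ℕ → Set where
  positive : ∀ {u} → Positive (suc u)

-- Subdividable sets for r ≥ 3

module ManyEdgesAtBothEnds
  {u r s : ℕ} {plus : Bool} (3≤r : 3 ≤ r) (3≤s : 3 ≤ s) (r+s<n : r + s < 6 + u)
  (F : EdgeSet (6 + u)) (F-sub : Subdividable (6 + u) (GAdj (6 + u) r s plus) F) where

  open AffineModel u 0 using (single-edge-minor)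

  7≤n : 7 ≤ 6 + u
  7≤n = ≤-trans (s≤s (+-mono-≤ 3≤r 3≤s)) r+s<n

  u-positive : Positive u
  u-positive = go 7≤n
    where
    go : ∀ {u} → 7 ≤ 6 + u → Positive u
    go {suc u} _ = positive
    go {zero} (s≤s (s≤s (s≤s (s≤s (s≤s (s≤s ()))))))

  s≤2+u : s ≤ 2 + u
  s≤2+u = +-cancelˡ-≤ 4 s (2 + u) (≤-trans (s≤s (+-monoˡ-≤ s 3≤r)) r+s<n)

  N≤ : ∀ {c k} → c ≤ r → suc (c + k) ≤ suc (r + k)
  N≤ c≤r = s≤s (+-monoˡ-≤ _ c≤r)

  only-spine : ∀ {a b} → F a b ≡ true → EdgeView (6 + u) r s plus (toℕ a) (toℕ b) → Spine (toℕ a) (toℕ b)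
  only-spine Fab (spine b≡) = b≡
  only-spine {a} {b} Fab (start a≡0 n≤ 2+b≤n) with m≤n⇒m<n∨m≡n (s≤s⁻¹ (s≤s⁻¹ 2+b≤n))
  ... | inj₁ b<4+u = ⊥-elim (F-sub (single-edge-minor v₁-plan (N≤ (≤-trans (s≤s z≤n) 3≤r)) 3≤s (λ ()) F
          (z≤n , subst (_< 2) (sym a≡0) (s≤s z≤n)) (≤-trans 3≤s s≤b , b<4+u) Fab))
    where
    -- From r + s < n ≤ b + r + 1: the chords of v_1 end at index s or later, hence beyond the first
    -- three vertices.
    s≤b : s ≤ toℕ b
    s≤b = +-cancelˡ-≤ r s _ (subst (r + s ≤_) (+-comm _ r) (s≤s⁻¹ (≤-trans r+s<n n≤)))
  ... | inj₂ b≡4+u with u-positive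
  ...   | positive {u′} = ⊥-elim (F-sub (AffineModel.single-edge-minor u′ 0 v₁v_n-1-plan
          (N≤ 3≤r) (≤-trans (s≤s (s≤s z≤n)) 3≤s) (λ ()) F
          (at a≡0) (≤-reflexive (sym b≡4+u) , subst (_< 7 + u′) (sym b≡4+u) (n≤1+n _)) Fab))
  only-spine {a} {b} Fab (finish 1+b≡n 1≤a a≤s) = ⊥-elim (F-sub (minor u-positive (toℕ a ≤? 1) (toℕ a ≤? 2)))
    where
    minor : Positive u → Dec (toℕ a ≤ 1) → Dec (toℕ a ≤ 2) →
            HasK24Minor (Subdivide (6 + u) (GAdj (6 + u) r s plus) F)
    minor (positive {u′}) (yes a≤1) _ = AffineModel.single-edge-minor u′ 0 v₂v_n-plan
      (N≤ (≤-trans (s≤s (s≤s z≤n)) 3≤r)) 3≤s (λ ()) F (z≤n , s≤s a≤1) (at (suc-injective 1+b≡n)) Fab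
    minor _ (no a≰1) (yes a≤2) = single-edge-minor v₃v_n-plan
      (N≤ 3≤r) (≤-trans (s≤s z≤n) 3≤s) (λ ()) F
      (≰⇒> a≰1 , ≤-trans (s≤s a≤2) (m≤m+n 3 u))
      (subst (4 + u ≤_) (suc-injective (sym 1+b≡n)) (n≤1+n _) , ≤-reflexive 1+b≡n) Fab
    minor _ _ (no a≰2) = single-edge-minor v_n-plan
      (N≤ (≤-trans (s≤s (s≤s z≤n)) 3≤r)) (≤-trans (s≤s (s≤s z≤n)) 3≤s) (λ ()) F
      (≰⇒> a≰2 , ≤-trans (s≤s (≤-trans a≤s s≤2+u)) (n≤1+n _)) (at (suc-injective 1+b≡n)) Fab
  only-spine {a} {b} Fab (chord plus≡ a≡0 1+b≡n) = ⊥-elim (F-sub (single-edge-minor v₁v_n-plan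
    (N≤ (≤-trans (s≤s (s≤s z≤n)) 3≤r)) (≤-trans (s≤s (s≤s z≤n)) 3≤s) (λ _ → plus≡) F
    (at a≡0) (at (suc-injective 1+b≡n)) Fab))

maximal⇔spine : ∀ {u r s plus} → 3 ≤ r → 3 ≤ s → r + s < 6 + u →
                ∀ F → MaximalSubdividable (6 + u) (GAdj (6 + u) r s plus) F ⇔ F ≐ Spine
maximal⇔spine {u} {r} {s} {plus} 3≤r 3≤s r+s<n F =
  mk⇔ (proj₂ ∘ Equivalence.to ⇔spine) (Equivalence.from ⇔spine ∘ (tt ,_))
  where
  ⇔spine = maximal⇔ {I = ⊤} (λ _ → Spine) (λ _ → spine?) (λ _ → spine-edge)
    (λ _ F → spine-subdividable (6 + u) r s plus F r+s<n)
    (λ F edges F-sub → tt , λ a b Fab → let a<b , ab = edges a b Fab in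
      ManyEdgesAtBothEnds.only-spine 3≤r 3≤s r+s<n F F-sub Fab
        (edgeView (s≤s (s≤s z≤n)) (orient (s≤s (s≤s z≤n)) a<b ab)))
    (λ _ _ _ _ _ p → p) F

-- Subdividable sets for r = 2

path2? : ∀ n a b → Dec (Path2 n a b)
path2? n a b = (b ≟ suc a ×-dec b ≤? n ∸ 3) ⊎-dec (a ≟ 0 ×-dec b ≟ n ∸ 2) ⊎-dec (a ≟ n ∸ 2 ×-dec b ≟ n ∸ 1)

path2-edge : ∀ {u s plus} (a b : Fin (6 + u)) → Path2 (6 + u) (toℕ a) (toℕ b) →
             toℕ a < toℕ b × GAdj (6 + u) 2 s plus a b
path2-edge a b (inj₁ (b≡ , _)) = spine-edge a b b≡
path2-edge {u} a b (inj₂ (inj₁ (a≡ , b≡))) =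
  subst₂ _<_ (sym a≡) (sym b≡) (s≤s z≤n) , inj₁ (inj₂ (inj₁ (a≡ , 1 , ≤-refl , s≤s z≤n , b≡)))
path2-edge a b (inj₂ (inj₂ (a≡ , b≡))) = spine-edge a b (trans b≡ (cong suc (sym a≡)))

index : ∀ {n m} → m < n → ∃ λ (i : Fin n) → toℕ i ≡ m
index m<n = fromℕ< m<n , Fin.toℕ-fromℕ< m<n

-- The edge v_{n-2}v_{n-1} is missing from the other path.
spine⊈path2 : ∀ u → ¬ (∀ (a b : Fin (6 + u)) → Spine (toℕ a) (toℕ b) → Path2 (6 + u) (toℕ a) (toℕ b))
spine⊈path2 u sub with index {6 + u} {3 + u} (m≤n+m (4 + u) 2) | index {6 + u} {4 + u} (m≤n+m (5 + u) 1)
... | a , a≡ | b , b≡ with subst₂ (Path2 (6 + u)) a≡ b≡ (sub a b (subst₂ Spine (sym a≡) (sym b≡) refl))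
...   | inj₁ (_ , b≤) = 1+n≰n b≤
...   | inj₂ (inj₂ (a≡′ , _)) = 1+n≢n (sym a≡′)

path2⊈spine : ∀ u → ¬ (∀ (a b : Fin (6 + u)) → Path2 (6 + u) (toℕ a) (toℕ b) → Spine (toℕ a) (toℕ b))
path2⊈spine u sub with index {6 + u} {4 + u} (m≤n+m (5 + u) 1)
... | b , b≡ = case trans (sym b≡) (sub zero b (inj₂ (inj₁ (refl , b≡)))) of λ ()

module TwoEdgesAtOneEnd
  {u s : ℕ} {plus : Bool} (4+u≤2+s : 4 + u ≤ 2 + s) (s≤3+u : s ≤ 3 + u)
  (large : (plus ≡ false × 4 ≤ s) ⊎ (plus ≡ true × 3 ≤ s))
  (F : EdgeSet (6 + u)) (F-sub : Subdividable (6 + u) (GAdj (6 + u) 2 s plus) F) where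

  open AffineModel u 0 using (single-edge-minor; edge-pair-minor)

  G′ : Graph
  G′ = Subdivide (6 + u) (GAdj (6 + u) 2 s plus) F

  3≤s : 3 ≤ s
  3≤s = [ (λ (_ , 4≤s) → ≤-trans (n≤1+n 3) 4≤s) , proj₂ ]′ large

  2≤s : 2 ≤ s
  2≤s = ≤-trans (n≤1+n 2) 3≤s

  2+u≤s : 2 + u ≤ s
  2+u≤s = s≤s⁻¹ (s≤s⁻¹ 4+u≤2+s)

  full-minor : ∀ {a b} → F a b ≡ true → 3 + u ≤ s → toℕ a < 2 + u → toℕ b ≡ 5 + u → HasK24Minor G′
  full-minor Fab 3+u≤s a< b≡ = single-edge-minor v_n-plan-full ≤-refl 3+u≤s (λ ()) F (z≤n , a<) (at b≡) Fab

  low-minor : ∀ {a b} → F a b ≡ true → toℕ a < 1 + u → toℕ b ≡ 5 + u → HasK24Minor G′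
  low-minor Fab a< b≡ = single-edge-minor v_n-plan-low ≤-refl 2+u≤s (λ ()) F (z≤n , a<) (at b≡) Fab

  -- The generic plans leave 1 + u ≤ a ≤ 2, so n ≤ 7. If a = 1, then n = 6 and s = 3 = n - 3. If a =
  -- 2, `large` gives either the edge v_1v_n or s ≥ 4, and the latter forces n = 7 and s = n - 3.
  spoke-minor : ∀ {a b} → F a b ≡ true → 1 ≤ toℕ a → toℕ a ≤ s → toℕ b ≡ 5 + u → HasK24Minor G′
  spoke-minor {a} {b} Fab 1≤a a≤s b≡ with toℕ a <? 1 + u | toℕ a ≤? 2
  ... | yes a<1+u | _ = low-minor Fab a<1+u b≡
  ... | no _ | no a≰2 = single-edge-minor v_n-plan ≤-refl 2≤s (λ ()) F (≰⇒> a≰2 , s≤s (≤-trans a≤s s≤3+u)) (at b≡) Fab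
  ... | no a≮1+u | yes a≤2 with toℕ a ≤? 1
  ...   | yes a≤1 = full-minor Fab (≤-trans (s≤s (s≤s (s≤s u≤0))) 3≤s) (≤-trans (s≤s a≤1) (m≤m+n 2 u)) b≡
    where
    u≤0 : u ≤ 0
    u≤0 = s≤s⁻¹ (≤-trans (≮⇒≥ a≮1+u) a≤1)
  ...   | no a≰1 = [ without-chord , with-chord ]′ large
    where
    with-chord : plus ≡ true × 3 ≤ s → HasK24Minor G′
    with-chord (plus≡ , _) = single-edge-minor v_n-plan-chord ≤-refl (≤-trans (s≤s z≤n) 2≤s) (λ _ → plus≡) F
      (≰⇒> a≰1 , ≤-trans (s≤s a≤2) (m≤m+n 3 (1 + u))) (at b≡) Fab
    without-chord : plus ≡ false × 4 ≤ s → HasK24Minor G′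
    without-chord (_ , 4≤s) = full-minor Fab
      (≤-trans (s≤s (s≤s (≤-trans (≮⇒≥ a≮1+u) a≤2))) 4≤s)
      (≤-trans (s≤s a≤2) (s≤s⁻¹ (≤-trans 4≤s s≤3+u))) b≡

  spine-or-path2 : ∀ {a b} → F a b ≡ true → EdgeView (6 + u) 2 s plus (toℕ a) (toℕ b) →
                   Spine (toℕ a) (toℕ b) ⊎ (toℕ a ≡ 0 × toℕ b ≡ 4 + u)
  spine-or-path2 Fab (spine b≡) = inj₁ b≡
  spine-or-path2 {a} {b} Fab (start a≡0 n≤ 2+b≤n) with m≤n⇒m<n∨m≡n (s≤s⁻¹ (s≤s⁻¹ 2+b≤n))
  ... | inj₁ b<4+u = ⊥-elim (F-sub (single-edge-minor v₁-plan (n≤1+n _) 3≤s (λ ()) F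
          (z≤n , subst (_< 2) (sym a≡0) (s≤s z≤n)) (≤-trans (m≤m+n 3 u) 3+u≤b , b<4+u) Fab))
    where
    3+u≤b : 3 + u ≤ toℕ b
    3+u≤b = s≤s⁻¹ (s≤s⁻¹ (s≤s⁻¹ (subst (6 + u ≤_) (cong suc (+-comm _ 2)) n≤)))
  ... | inj₂ b≡4+u = inj₂ (a≡0 , b≡4+u)
  spine-or-path2 Fab (finish 1+b≡n 1≤a a≤s) =
    ⊥-elim (F-sub (spoke-minor Fab 1≤a a≤s (suc-injective 1+b≡n)))
  spine-or-path2 Fab (chord plus≡ a≡0 1+b≡n) = ⊥-elim (F-sub (single-edge-minor v₁v_n-plan
    ≤-refl 2≤s (λ _ → plus≡) F (at a≡0) (at (suc-injective 1+b≡n)) Fab))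

  not-both : ∀ {a b c d} → F a b ≡ true → toℕ a ≡ 0 → toℕ b ≡ 4 + u →
             F c d ≡ true → toℕ c ≡ 3 + u → toℕ d ≢ 4 + u
  not-both Fab a≡ b≡ Fcd c≡ d≡ = F-sub (edge-pair-minor v_n-1-pair-plan ≤-refl 2≤s (λ ()) F
    (λ where refl → case trans (sym a≡) c≡ of λ ())
    (at a≡) (last b≡) Fab (at c≡) (last d≡) Fcd)
    where
    last : ∀ {x} → x ≡ 4 + u → 4 + u ≤ x × x < 6 + u
    last refl = ≤-refl , n≤1+n _

maximal⇔spine-or-path2 : ∀ {u s plus} → 4 + u ≤ 2 + s → s ≤ 3 + u →
  (plus ≡ false × 4 ≤ s) ⊎ (plus ≡ true × 3 ≤ s) →
  ∀ F → MaximalSubdividable (6 + u) (GAdj (6 + u) 2 s plus) F ⇔ (F ≐ Spine ⊎ F ≐ Path2 (6 + u))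
maximal⇔spine-or-path2 {u} {s} {plus} 4+u≤2+s s≤3+u large F =
  mk⇔ (λ p → case Equivalence.to ⇔P p of λ where
        (true , eq)  → inj₁ eq
        (false , eq) → inj₂ eq)
      [ Equivalence.from ⇔P ∘ (true ,_) , Equivalence.from ⇔P ∘ (false ,_) ]′
  where
  n : ℕ
  n = 6 + u
  P : Bool → ℕ → ℕ → Set
  P true  = Spine
  P false = Path2 n
  P? : ∀ i a b → Dec (P i a b)
  P? true  = spine?
  P? false = path2? n
  P-edge : ∀ i (a b : Fin n) → P i (toℕ a) (toℕ b) → toℕ a < toℕ b × GAdj n 2 s plus a b
  P-edge true  = spine-edge
  P-edge false = path2-edge
  P-subdividable : ∀ i F → F ≐ P i → Subdividable n (GAdj n 2 s plus) F
  P-subdividable true  F = spine-subdividable n 2 s plus F (s≤s (s≤s (s≤s s≤3+u)))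
  P-subdividable false F = path2-subdividable n s plus F (s≤s (s≤s (s≤s z≤n))) s≤3+u
  antichain : ∀ i j → (∀ (a b : Fin n) → P i (toℕ a) (toℕ b) → P j (toℕ a) (toℕ b)) →
              ∀ (a b : Fin n) → P j (toℕ a) (toℕ b) → P i (toℕ a) (toℕ b)
  antichain true  true  _ _ _ p = p
  antichain false false _ _ _ p = p
  antichain true  false sub = ⊥-elim (spine⊈path2 u sub)
  antichain false true  sub = ⊥-elim (path2⊈spine u sub)
  path2-unless : ∀ {a b} → b < n → b ≡ suc a → b ≢ 4 + u → Path2 n a b
  path2-unless b<n b≡ b≢ with m≤n⇒m<n∨m≡n (s≤s⁻¹ b<n)
  ... | inj₁ b<5+u = inj₁ (b≡ , s≤s⁻¹ (≤∧≢⇒< (s≤s⁻¹ b<5+u) b≢))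
  ... | inj₂ b≡5+u = inj₂ (inj₂ (suc-injective (trans (sym b≡) b≡5+u) , b≡5+u))
  either : ∀ F → IsEdgeSet n (GAdj n 2 s plus) F → Subdividable n (GAdj n 2 s plus) F →
           ∀ a b → F a b ≡ true → Spine (toℕ a) (toℕ b) ⊎ (toℕ a ≡ 0 × toℕ b ≡ 4 + u)
  either F edges F-sub a b Fab = let a<b , ab = edges a b Fab in
    TwoEdgesAtOneEnd.spine-or-path2 4+u≤2+s s≤3+u large F F-sub Fab (edgeView (s≤s (s≤s z≤n)) (orient (s≤s (s≤s z≤n)) a<b ab))
  cover : ∀ F → IsEdgeSet n (GAdj n 2 s plus) F → Subdividable n (GAdj n 2 s plus) F →
          ∃ λ i → ∀ a b → F a b ≡ true → P i (toℕ a) (toℕ b)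
  cover F edges F-sub with index {n} {4 + u} (m≤n+m (5 + u) 1)
  -- The edge v_1v_{n-1} decides: if F contains it, F cannot contain v_{n-2}v_{n-1}.
  ... | v , v≡ with F zero v Bool.≟ true
  ...   | yes F0v = false , λ a b Fab → case either F edges F-sub a b Fab of λ where
    (inj₂ (a≡ , b≡)) → inj₂ (inj₁ (a≡ , b≡))
    (inj₁ b≡) → path2-unless (Fin.toℕ<n b) b≡ λ b≡′ →
      TwoEdgesAtOneEnd.not-both 4+u≤2+s s≤3+u large F F-sub F0v refl v≡ Fab (suc-injective (trans (sym b≡) b≡′)) b≡′
  ...   | no ¬F0v = true , λ a b Fab → case either F edges F-sub a b Fab of λ where
      (inj₁ b≡) → b≡
      (inj₂ (a≡ , b≡)) → ⊥-elim (¬F0v (subst₂ (λ x y → F x y ≡ true)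
        (Fin.toℕ-injective a≡) (Fin.toℕ-injective (trans b≡ (sym v≡))) Fab))
  ⇔P = maximal⇔ P P? P-edge P-subdividable cover antichain F

-- Subdividable sets in the wheel

wheelAdj : ∀ u → Fin (6 + u) → Fin (6 + u) → Set
wheelAdj u = GAdj (6 + u) 1 (3 + u) true

rimSpoke? : ∀ n k a b → Dec (RimSpoke n k a b)
rimSpoke? n k a b = ((b ≟ suc a ×-dec b ≤? n ∸ 2) ⊎-dec (a ≟ 0 ×-dec b ≟ n ∸ 2)) ⊎-dec (a ≟ k ×-dec b ≟ n ∸ 1)

rimSpoke-edge : ∀ {u k} → k < 5 + u → (a b : Fin (6 + u)) → RimSpoke (6 + u) k (toℕ a) (toℕ b) →
                toℕ a < toℕ b × wheelAdj u a b
rimSpoke-edge k< a b (inj₁ (inj₁ (b≡ , _))) = spine-edge a b b≡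
rimSpoke-edge k< a b (inj₁ (inj₂ (a≡ , b≡))) =
  subst₂ _<_ (sym a≡) (sym b≡) (s≤s z≤n) , inj₁ (inj₂ (inj₁ (a≡ , 1 , ≤-refl , ≤-refl , b≡)))
rimSpoke-edge {u} {k} k< a b (inj₂ (a≡ , b≡)) = subst₂ _<_ (sym a≡) (sym b≡) k< , inj₁ (spoke (toℕ a) a≡)
  where
  -- The spoke is v_1v_n for k = 0, the last spine edge for k = n - 2, and a chord of v_n otherwise.
  spoke : ∀ x → x ≡ k → BaseEdge (6 + u) 1 (3 + u) true x (toℕ b)
  spoke zero    x≡ = inj₂ (inj₂ (inj₂ (refl , refl , b≡)))
  spoke (suc x) x≡ with m≤n⇒m<n∨m≡n (s≤s⁻¹ (subst (_< 5 + u) (sym x≡) k<))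
  ... | inj₁ x<4+u = inj₂ (inj₂ (inj₁ (b≡ , suc x , s≤s z≤n , s≤s⁻¹ x<4+u , refl)))
  ... | inj₂ refl  = inj₁ b≡

rimSpoke-subdividable′ : ∀ {m} k l → k + l ≡ m → (F : EdgeSet (2 + m)) → F ≐ RimSpoke (2 + m) k →
                         Subdividable (2 + m) (GAdj (2 + m) 1 (2 + m ∸ 3) true) F
rimSpoke-subdividable′ k l refl = rimSpoke-subdividable k l

rimSpoke-spoke : ∀ {u k l} → k < 5 + u → (∀ (a b : Fin (6 + u)) → RimSpoke (6 + u) k (toℕ a) (toℕ b) →
                 RimSpoke (6 + u) l (toℕ a) (toℕ b)) → k ≡ l
rimSpoke-spoke {u} {k} k< sub with index {6 + u} (≤-trans k< (n≤1+n _)) | index {6 + u} {5 + u} ≤-refl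
... | a , a≡ | b , b≡ with subst₂ (RimSpoke (6 + u) _) a≡ b≡ (sub a b (inj₂ (a≡ , b≡)))
...   | inj₁ (inj₁ (_ , b≤))  = ⊥-elim (1+n≰n b≤)
...   | inj₁ (inj₂ (_ , eq))  = ⊥-elim (1+n≢n eq)
...   | inj₂ (k≡l , _)        = k≡l

-- The rim has at least five vertices, so some adjacent pair avoids both spokes: indices 0, 1 if a ≥
-- 2; 2, 3 if c ≥ 4; the last two if c ≤ 2; otherwise c = 3, and the pair is 1, 2 if a = 0 and
-- v_{n-1}, v_1 if a = 1.
two-spokes-minor : ∀ {u} (F : EdgeSet (6 + u)) {a b c d} → F a b ≡ true → F c d ≡ true →
                   toℕ b ≡ 5 + u → toℕ d ≡ 5 + u → toℕ a < toℕ c → toℕ c < 5 + u →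
                   HasK24Minor (Subdivide (6 + u) (wheelAdj u) F)
two-spokes-minor {u} F {a} {b} {c} {d} Fab Fcd b≡ d≡ a<c c< =
  minor (2 ≤? toℕ a) (4 ≤? toℕ c) (toℕ c ≤? 2) (toℕ a ≤? 0)
  where
  open AffineModel u 0 using (edge-pair-minor)
  a≢c : a ≢ c
  a≢c refl = <-irrefl refl a<c
  minor : Dec (2 ≤ toℕ a) → Dec (4 ≤ toℕ c) → Dec (toℕ c ≤ 2) → Dec (toℕ a ≤ 0) →
          HasK24Minor (Subdivide (6 + u) (wheelAdj u) F)
  minor (yes 2≤a) _ _ _ = edge-pair-minor spokes-plan-0,1 ≤-refl ≤-refl id F a≢c
    (2≤a , <-trans a<c c<) (at b≡) Fab (≤-trans 2≤a (<⇒≤ a<c) , c<) (at d≡) Fcd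
  minor (no 2≰a) (yes 4≤c) _ _ = edge-pair-minor spokes-plan-2,3 ≤-refl ≤-refl id F a≢c
    (z≤n , ≰⇒> 2≰a) (at b≡) Fab (4≤c , c<) (at d≡) Fcd
  minor (no 2≰a) (no _) (yes c≤2) _ = edge-pair-minor spokes-plan-end ≤-refl ≤-refl id F a≢c
    (z≤n , ≤-trans (<⇒≤ (s≤s a<c)) c≤) (at b≡) Fab (z≤n , c≤) (at d≡) Fcd
    where
    c≤ : toℕ c < 3 + u
    c≤ = ≤-trans (s≤s c≤2) (m≤m+n 3 u)
  minor (no _) (no _) (no c≰2) (yes a≤0) = edge-pair-minor spokes-plan-1,2 ≤-refl ≤-refl id F a≢c
    (z≤n , s≤s a≤0) (at b≡) Fab (≰⇒> c≰2 , c<) (at d≡) Fcd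
  minor (no 2≰a) (no 4≰c) (no _) (no a≰0) = edge-pair-minor spokes-plan-wrap ≤-refl ≤-refl id F a≢c
    (≰⇒> a≰0 , <-trans a<c c<4+u) (at b≡) Fab (≤-trans (≰⇒> a≰0) (<⇒≤ a<c) , c<4+u) (at d≡) Fcd
    where
    c<4+u : toℕ c < 4 + u
    c<4+u = ≤-trans (≰⇒> 4≰c) (m≤m+n 4 u)

maximal⇔rimSpoke : ∀ u F → MaximalSubdividable (6 + u) (wheelAdj u) F ⇔
                           (∃ λ k → k < 5 + u × F ≐ RimSpoke (6 + u) k)
maximal⇔rimSpoke u F = mk⇔ (λ p → let k , eq = Equivalence.to ⇔P p in toℕ k , Fin.toℕ<n k , eq)
  λ (k , k< , eq) → Equivalence.from ⇔P (fromℕ< k< , subst (λ x → F ≐ RimSpoke n x) (sym (Fin.toℕ-fromℕ< k<)) eq)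
  where
  n : ℕ
  n = 6 + u
  P : Fin (5 + u) → ℕ → ℕ → Set
  P k = RimSpoke n (toℕ k)
  rim-or : ∀ {k a b} → b < n → (b ≡ 5 + u → RimSpoke n k a b) → EdgeView n 1 (3 + u) true a b →
           RimSpoke n k a b
  rim-or b<n spoke (spine b≡) with m≤n⇒m<n∨m≡n (s≤s⁻¹ b<n)
  ... | inj₁ b<5+u = inj₁ (inj₁ (b≡ , s≤s⁻¹ b<5+u))
  ... | inj₂ b≡5+u = spoke b≡5+u
  rim-or {b = b} _ _ (start a≡0 n≤ 2+b≤n) = inj₁ (inj₂ (a≡0 , ≤-antisym (s≤s⁻¹ (s≤s⁻¹ 2+b≤n))
    (s≤s⁻¹ (s≤s⁻¹ (subst (n ≤_) (cong suc (+-comm b 1)) n≤)))))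
  rim-or _ spoke (finish 1+b≡n _ _) = spoke (suc-injective 1+b≡n)
  rim-or _ spoke (chord _ _ 1+b≡n)  = spoke (suc-injective 1+b≡n)
  rim-or-spoke : ∀ {F k} → IsEdgeSet n (wheelAdj u) F → ∀ a b → F a b ≡ true →
                 (toℕ b ≡ 5 + u → RimSpoke n k (toℕ a) (toℕ b)) → RimSpoke n k (toℕ a) (toℕ b)
  rim-or-spoke edges a b Fab spoke = let a<b , ab = edges a b Fab in
    rim-or (Fin.toℕ<n b) spoke (edgeView (s≤s (s≤s z≤n)) (orient (s≤s (s≤s z≤n)) a<b ab))
  cover : ∀ F → IsEdgeSet n (wheelAdj u) F → Subdividable n (wheelAdj u) F →
          ∃ λ k → ∀ a b → F a b ≡ true → P k (toℕ a) (toℕ b)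
  cover F edges F-sub with Fin.any? (λ k → F k (fromℕ (5 + u)) Bool.≟ true)
  -- A set without spokes lies in the rim, so any spoke may be assigned; 0 is arbitrary.
  ... | no none = zero , λ a b Fab → rim-or-spoke {F} edges a b Fab λ b≡ → ⊥-elim (none (a ,
          subst (λ x → F a x ≡ true) (Fin.toℕ-injective (trans b≡ (sym (Fin.toℕ-fromℕ (5 + u))))) Fab))
  ... | yes (k , Fk) = fromℕ< k< , λ a b Fab → rim-or-spoke {F} edges a b Fab λ b≡ →
          inj₂ (trans (unique a b Fab b≡) (sym (Fin.toℕ-fromℕ< k<)) , b≡)
    where
    hub≡ : toℕ (fromℕ (5 + u)) ≡ 5 + u
    hub≡ = Fin.toℕ-fromℕ (5 + u)
    spoke< : ∀ a b → F a b ≡ true → toℕ b ≡ 5 + u → toℕ a < 5 + u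
    spoke< a b Fab b≡ = subst (toℕ a <_) b≡ (proj₁ (edges a b Fab))
    k< : toℕ k < 5 + u
    k< = spoke< k _ Fk hub≡
    unique : ∀ a b → F a b ≡ true → toℕ b ≡ 5 + u → toℕ a ≡ toℕ k
    unique a b Fab b≡ with <-cmp (toℕ a) (toℕ k)
    ... | tri< a<k _ _ = ⊥-elim (F-sub (two-spokes-minor F Fab Fk b≡ hub≡ a<k k<))
    ... | tri≈ _ a≡k _ = a≡k
    ... | tri> _ _ k<a = ⊥-elim (F-sub (two-spokes-minor F Fk Fab hub≡ b≡ k<a (spoke< a b Fab b≡)))
  ⇔P = maximal⇔ P (λ k → rimSpoke? n (toℕ k)) (λ k → rimSpoke-edge (Fin.toℕ<n k))
    (λ k → rimSpoke-subdividable′ (toℕ k) (4 + u ∸ toℕ k) (m+[n∸m]≡n (Fin.toℕ≤pred[n] k)))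
    cover (λ k l sub a b p → subst (λ x → RimSpoke n x _ _) (sym (rimSpoke-spoke (Fin.toℕ<n k) sub)) p) F

-- The upper bound on r + s, and the theorem

two-common-neighbours-minor : ∀ v t r plus → 6 + (v + t) ≤ r + (3 + v) →
                              HasK24Minor (GG (6 + (v + t)) r (3 + v) plus)
two-common-neighbours-minor v t r plus n≤ = AffineModel.plain-minor v t twoCommonNeighbours-plan
  {r = r} {s = 3 + v} {plus = plus} (≤-trans n≤ (≤-reflexive (+-suc r (2 + v)))) ≤-refl λ ()

-- If r + s ≥ n, both v_s and v_{s+1} are adjacent to v_1 and to v_n. As r ≤ n - 3, this forces s ≥
-- 3, so s = 3 + v, and t is the slack n - 3 - s.
K24MinorFree⇒degrees : ∀ u r s plus → r ≤ 3 + u → s ≤ 3 + u → K24MinorFree (GG (6 + u) r s plus) → r + s < 6 + u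
K24MinorFree⇒degrees u r s plus r≤ s≤ free = ≰⇒> λ n≤ → free (minor n≤ (s-large n≤))
  where
  s-large : 6 + u ≤ r + s → 3 ≤ s
  s-large n≤ = +-cancelˡ-≤ (3 + u) 3 s (≤-trans (≤-reflexive (+-comm (3 + u) 3)) (≤-trans n≤ (+-monoˡ-≤ s r≤)))
  minor : 6 + u ≤ r + s → 3 ≤ s → HasK24Minor (GG (6 + u) r s plus)
  minor n≤ 3≤s with m≤n⇒∃[o]m+o≡n 3≤s
  ... | v , refl with m≤n⇒∃[o]m+o≡n (s≤s⁻¹ (s≤s⁻¹ (s≤s⁻¹ s≤)))
  ...   | t , refl = two-common-neighbours-minor v t r plus n≤

theorem3p6 : (n r s : ℕ) (plus : Bool) →
    6 ≤ n → r ≤ n ∸ 3 → s ≤ n ∸ 3 → r ≤ s → InClassG n r s plus →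
    (r ≡ 1 →
    plus ≡ true × s ≡ n ∸ 3
    × (∀ (F : EdgeSet n) → MaximalSubdividable n (GAdj n r s plus) F
    ⇔ (∃ λ k → k < n ∸ 1 × F ≐ RimSpoke n k))
    × (∀ k l → k < n ∸ 1 → l < n ∸ 1 →
    SameEdges n (RimSpoke n k) (RimSpoke n l) → k ≡ l))
    × (r ≡ 2 → (plus ≡ false × 4 ≤ s) ⊎ (plus ≡ true × 3 ≤ s) →
    (∀ (F : EdgeSet n) → MaximalSubdividable n (GAdj n r s plus) F
    ⇔ (F ≐ Spine ⊎ F ≐ Path2 n))
    × ¬ SameEdges n Spine (Path2 n))
    × (3 ≤ r →
    ∀ (F : EdgeSet n) → MaximalSubdividable n (GAdj n r s plus) F
    ⇔ F ≐ Spine)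
theorem3p6 .(6 + u) r s plus (s≤s (s≤s (s≤s (s≤s (s≤s (s≤s (z≤n {u}))))))) r≤ s≤ r≤s (connected , free) =
  wheel , two-sets , λ 3≤r → maximal⇔spine 3≤r (≤-trans 3≤r r≤s) (K24MinorFree⇒degrees u r s plus r≤ s≤ free)
  where
  degrees : 4 + u ≤ r + s
  degrees = threeConnected⇒degrees u r s plus s≤ connected
  wheel : _
  -- With r = 1, r + s ≥ n - 2 forces s = n - 3, and v_1 gets its third neighbour only from the edge
  -- v_1v_n.
  wheel refl with threeConnected⇒chord u s plus connected | ≤-antisym s≤ (s≤s⁻¹ degrees)
  ... | refl | refl = refl , refl , maximal⇔rimSpoke u ,
    λ k l k< _ same → rimSpoke-spoke k< λ a b → Equivalence.to (same a b)
  two-sets : _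
  two-sets refl large = maximal⇔spine-or-path2 degrees s≤ large ,
    λ same → spine⊈path2 u λ a b → Equivalence.to (same a b)
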